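{- The index set $\{i\mid R_i\text{ is self-full}\}$ is $\Pi^0_3$-complete.
   Context: A ceer is a computably enumerable equivalence relation on $\omega$. $(R_z)_{z\in\omega}$ is a fixed acceptable indexing of all ceers (for instance $R_z$ is the equivalence relation on $\omega$ generated by the $z$-th c.e. subset of $\omega^2$). A computable function $g$ is a reduction of $E$ to $E$ if $x\mathrel{E}y\iff g(x)\mathrel{E}g(y)$ for all $x,y$. A ceer $E$ is self-full if for every such reduction $g$ of $E$ to $E$ and every $j\in\omega$ there is $k$ with $g(k)\mathrel{E}j$. -}

module Defs where

open import Data.Nat using (ℕ; zero; suc; _+_; _*_; _%_; _/_; _<_)
open import Data.Product using (Σ; _×_; _,_; proj₁; proj₂)
open import Relation.Binary.PropositionalEquality using (_≡_)
open import Function.Bundles using (_⇔_)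
open import Data.Empty using (⊥)

-- Cantor pairing ⟨a,b⟩ = tri (a+b) + a  and its inverse (enumeration
-- along diagonals: (0,0),(0,1),(1,0),(0,2),(1,1),(2,0),...)

tri : ℕ → ℕ
tri zero    = zero
tri (suc n) = suc n + tri n

pair : ℕ → ℕ → ℕ
pair a b = tri (a + b) + a

private
  next : ℕ × ℕ → ℕ × ℕ
  next (a , suc b) = (suc a , b)
  next (a , zero)  = (zero , suc a)

unpair : ℕ → ℕ × ℕ
unpair zero    = (zero , zero)
unpair (suc n) = next (unpair n)

fst snd : ℕ → ℕ
fst n = proj₁ (unpair n)
snd n = proj₂ (unpair n)

-- A Turing-complete model: unary partial recursive functions on ℕ
-- (with Cantor pairing as the built-in tupling).

data Code : Set where
  zeroC succC idC fstC sndC : Code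
  pairC compC precC         : Code → Code → Code
  muC                       : Code → Code

data Eval : Code → ℕ → ℕ → Set where
  ezero : ∀ {x} → Eval zeroC x 0
  esucc : ∀ {x} → Eval succC x (suc x)
  eid   : ∀ {x} → Eval idC x x
  efst  : ∀ {x} → Eval fstC x (fst x)
  esnd  : ∀ {x} → Eval sndC x (snd x)
  epair : ∀ {f g x y z} → Eval f x y → Eval g x z → Eval (pairC f g) x (pair y z)
  ecomp : ∀ {f g x y z} → Eval g x y → Eval f y z → Eval (compC f g) x z
  -- primitive recursion: h⟨x,0⟩ = f x ; h⟨x,n+1⟩ = g⟨x,⟨n,h⟨x,n⟩⟩⟩
  -- (h applied to a non-canonical input is h applied to its decoding)
  eprec0 : ∀ {f g x y} → Eval f (fst x) y → snd x ≡ 0 → Eval (precC f g) x y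
  eprecS : ∀ {f g x n y z} → snd x ≡ suc n →
           Eval (precC f g) (pair (fst x) n) y →
           Eval g (pair (fst x) (pair n y)) z → Eval (precC f g) x z
  emu : ∀ {f x n} → Eval f (pair x n) 0 →
        (∀ m → m < n → Σ ℕ λ v → Eval f (pair x m) (suc v)) →
        Eval (muC f) x n

-- Gödel numbering of codes: n ↦ tag n % 9, payload n / 9 (split by unpair).
-- Fuel suc n suffices since payload components are < n for n > 0,
-- so every code gets a number (computable encoding/decoding: an
-- acceptable numbering).

private
  dec' : ℕ → ℕ → Code
  dec' zero n = zeroC
  dec' (suc k) n with n % 9
  ... | 0 = zeroC
  ... | 1 = succC
  ... | 2 = idC
  ... | 3 = fstC
  ... | 4 = sndC
  ... | 5 = pairC (dec' k (fst (n / 9))) (dec' k (snd (n / 9)))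
  ... | 6 = compC (dec' k (fst (n / 9))) (dec' k (snd (n / 9)))
  ... | 7 = precC (dec' k (fst (n / 9))) (dec' k (snd (n / 9)))
  ... | _ = muC (dec' k (n / 9))

decode : ℕ → Code
decode n = dec' (suc n) n

Φ : ℕ → ℕ → ℕ → Set
Φ e x y = Eval (decode e) x y

Computable : (ℕ → ℕ) → Set
Computable g = Σ ℕ λ e → ∀ x → Φ e x (g x)

W : ℕ → ℕ → Set
W e x = Σ ℕ λ y → Φ e x y

data R (z : ℕ) : ℕ → ℕ → Set where
  gen   : ∀ {a b} → W z (pair a b) → R z a b
  rrefl : ∀ {a} → R z a a
  rsym  : ∀ {a b} → R z a b → R z b a
  rtrans : ∀ {a b c} → R z a b → R z b c → R z a c

IsReduction : (ℕ → ℕ → Set) → (ℕ → ℕ) → Set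
IsReduction E g = ∀ x y → E x y ⇔ E (g x) (g y)

SelfFull : (ℕ → ℕ → Set) → Set
SelfFull E = ∀ (g : ℕ → ℕ) → Computable g → IsReduction E g →
             ∀ j → Σ ℕ λ k → E (g k) j

Π⁰₃ : (ℕ → Set) → Set
Π⁰₃ A = Σ (ℕ → ℕ) λ r → Computable r ×
          (∀ x → A x ⇔ (∀ a → Σ ℕ λ b → ∀ c → r (pair x (pair a (pair b c))) ≡ 0))

_≤ₘ_ : (ℕ → Set) → (ℕ → Set) → Set
B ≤ₘ A = Σ (ℕ → ℕ) λ f → Computable f × (∀ x → B x ⇔ A (f x))

Π⁰₃-complete : (ℕ → Set) → Set₁
Π⁰₃-complete A = Π⁰₃ A × (∀ (B : ℕ → Set) → Π⁰₃ B → B ≤ₘ A)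

SelfFullIndex : ℕ → Set
SelfFullIndex i = SelfFull (R i)

{-# OPTIONS --safe #-}
module Submission where

open import Defs
open import Level using (0ℓ)
open import Axiom.ExcludedMiddle using (ExcludedMiddle)
open import Data.Nat
open import Data.Nat.Properties
open import Data.Nat.DivMod
open import Data.Product using (Σ; ∃; _×_; _,_; proj₁; proj₂)
open import Data.Sum using (_⊎_; inj₁; inj₂; [_,_]′)
open import Relation.Nullary using (¬_; yes; no; contradiction)
open import Relation.Binary using (tri<; tri≈; tri>)
open import Relation.Binary.PropositionalEquality
open import Function using (_∘_; _⇔_; mk⇔; Equivalence)
open import Relation.Nullary.Decidable using (decidable-stable)
open import Data.Fin using (toℕ; fromℕ<)
open import Data.Fin.Properties using (pigeonhole; toℕ-fromℕ<)
open import Data.List using (List; []; _∷_)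
open import Relation.Binary.Construct.Closure.ReflexiveTransitive using (Star; ε; _◅_; _◅◅_; reverse)

-- Membership: R i is self-full iff for all e and j either φₑ fails to be a reduction of
-- R i to itself, or φₑ(k) R i j for some k; both alternatives are Σ⁰₂ once a universal
-- machine makes "φₑ(x) = y within s steps" computable.
--
-- Hardness: consider the ceer with A as its only nontrivial class, where A is built
-- like Post's simple set: requirement e puts into A the first value of φₑ outside the
-- protected sets P₀, …, Pₑ. These are uniformly computable, and Pₐ is infinite iff a refutes
-- the Π⁰₃ condition. If all Pₐ are finite, A meets the range of every computable
-- injection; the orbit j, g j, g (g j), … of a class j missed by a reduction g would
-- then contain two elements of A, yet it is pairwise inequivalent. If Pₐ is infinite,
-- only the requirements e < a reach it, so Pₐ ∩ A is finite, and moving each element of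
-- Pₐ beyond A to the next one is a reduction that misses a class.

-- Pairing and Gödel numbering

-- Defs keeps the fuelled decoder private; unification recovers it from an
-- unfolded occurrence in a goal.

data Any : Code → Set where
  any : ∀ {c} → Any c

left-payload : ∀ {l r} (c : Code) → c ≡ l → Any (pairC l r)
left-payload _ _ = any

mutual
  decodeFuel : ℕ → ℕ → Code
  decodeFuel = _

  recover-decodeFuel : ∀ n → Any (decode n)
  recover-decodeFuel n with n % 9
  -- Abstracting the payload leaves the unknown decoder applied to the distinct variables `n` and
  -- `m`, a pattern problem with a unique solution.
  ... | 5 with fst (n / 9)
  ...   | m = left-payload (decodeFuel n m) refl
  recover-decodeFuel n | _ = any

-- Each successor moves one place along the diagonal, so `a` steps after its start `(0 , s)` the
-- first component has grown to `a`.
unpair-diagonal : ∀ s n → unpair n ≡ (0 , s) → ∀ a b → a + b ≡ s → unpair (a + n) ≡ (a , b)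
unpair-diagonal s n eq zero b refl = eq
unpair-diagonal s n eq (suc a) b a+b≡s
  rewrite unpair-diagonal s n eq a (suc b) (trans (+-suc a b) a+b≡s) = refl

unpair-tri : ∀ s → unpair (tri s) ≡ (0 , s)
unpair-tri zero = refl
unpair-tri (suc s) rewrite unpair-diagonal s (tri s) (unpair-tri s) s 0 (+-identityʳ s) = refl

unpair-pair : ∀ a b → unpair (pair a b) ≡ (a , b)
unpair-pair a b = trans (cong unpair (+-comm (tri (a + b)) a))
  (unpair-diagonal (a + b) (tri (a + b)) (unpair-tri (a + b)) a b refl)

fst-pair : ∀ a b → fst (pair a b) ≡ a
fst-pair a b = cong proj₁ (unpair-pair a b)

snd-pair : ∀ a b → snd (pair a b) ≡ b
snd-pair a b = cong proj₂ (unpair-pair a b)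

-- A step along a diagonal keeps the sum of the components; a wrap to the next diagonal raises it by
-- one.
fst+snd≤ : ∀ n → fst n + snd n ≤ n
fst+snd≤ zero = z≤n
fst+snd≤ (suc n) with unpair n | fst+snd≤ n
... | a , suc b | h = m≤n⇒m≤1+n (subst (_≤ n) (+-suc a b) h)
... | a , zero  | h = s≤s (subst (_≤ n) (+-identityʳ a) h)

fst≤ : ∀ n → fst n ≤ n
fst≤ n = ≤-trans (m≤m+n _ _) (fst+snd≤ n)

snd≤ : ∀ n → snd n ≤ n
snd≤ n = ≤-trans (m≤n+m _ (fst n)) (fst+snd≤ n)

tri-mono : ∀ {m n} → m ≤ n → tri m ≤ tri n
tri-mono z≤n = z≤n
tri-mono (s≤s m≤n) = s≤s (+-mono-≤ m≤n (tri-mono m≤n))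

n≤tri : ∀ n → n ≤ tri n
n≤tri zero = z≤n
n≤tri (suc n) = s≤s (m≤m+n n (tri n))

snd≤pair : ∀ a b → b ≤ pair a b
snd≤pair a b = ≤-trans (m≤n+m b a) (≤-trans (n≤tri (a + b)) (m≤m+n _ a))

pair-mono-≤ : ∀ {a b c d} → a ≤ c → b ≤ d → pair a b ≤ pair c d
pair-mono-≤ a≤c b≤d = +-mono-≤ (tri-mono (+-mono-≤ a≤c b≤d)) a≤c

pair-unpair : ∀ n → pair (fst n) (snd n) ≡ n
pair-unpair zero = refl
pair-unpair (suc n) with unpair n | pair-unpair n
... | a , suc b | h = trans (trans (cong (λ s → tri s + suc a) (sym (+-suc a b))) (+-suc _ a)) (cong suc h)
... | a , zero  | h = cong suc (trans (trans (+-identityʳ _) (+-comm a (tri a)))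
                        (trans (cong (λ s → tri s + a) (sym (+-identityʳ a))) h))

-- Division by 9 strictly decreases positive numbers only; 0 is set apart, and there the tag 0 ends
-- the recursion.
payload<fuel : ∀ k n → n < suc k → n / 9 < k ⊎ n ≡ 0
payload<fuel k zero _ = inj₂ refl
payload<fuel k (suc n) (s≤s n<k) = inj₁ (<-≤-trans (m/n<m (suc n) 9 (s≤s (s≤s z≤n))) n<k)

decodeFuel-irrelevant : ∀ k l n → n < k → n < l → decodeFuel k n ≡ decodeFuel l n
decodeFuel-irrelevant (suc k) (suc l) n n<k n<l with payload<fuel k n n<k | payload<fuel l n n<l
... | inj₂ refl | _ = refl
... | inj₁ _ | inj₂ refl = refl
... | inj₁ p<k | inj₁ p<l = cases
  where
  same : ∀ m → m ≤ n / 9 → decodeFuel k m ≡ decodeFuel l m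
  same m m≤ = decodeFuel-irrelevant k l m (≤-<-trans m≤ p<k) (≤-<-trans m≤ p<l)
  cases : decodeFuel (suc k) n ≡ decodeFuel (suc l) n
  cases with n % 9
  ... | 0 = refl
  ... | 1 = refl
  ... | 2 = refl
  ... | 3 = refl
  ... | 4 = refl
  ... | 5 = cong₂ pairC (same _ (fst≤ (n / 9))) (same _ (snd≤ (n / 9)))
  ... | 6 = cong₂ compC (same _ (fst≤ (n / 9))) (same _ (snd≤ (n / 9)))
  ... | 7 = cong₂ precC (same _ (fst≤ (n / 9))) (same _ (snd≤ (n / 9)))
  ... | suc (suc (suc (suc (suc (suc (suc (suc _))))))) = cong muC (same _ ≤-refl)

decodeNode : ℕ → ℕ → Code
decodeNode 0 p = zeroC
decodeNode 1 p = succC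
decodeNode 2 p = idC
decodeNode 3 p = fstC
decodeNode 4 p = sndC
decodeNode 5 p = pairC (decode (fst p)) (decode (snd p))
decodeNode 6 p = compC (decode (fst p)) (decode (snd p))
decodeNode 7 p = precC (decode (fst p)) (decode (snd p))
decodeNode (suc (suc (suc (suc (suc (suc (suc (suc _)))))))) p = muC (decode p)

-- The recursion equation of `decode` with the fuel eliminated. The machine below dispatches on
-- exactly this tag and payload.
decode-node : ∀ n → decode n ≡ decodeNode (n % 9) (n / 9)
decode-node zero = refl
decode-node n@(suc _) = cases
  where
  same : ∀ i → i ≤ n / 9 → decodeFuel n i ≡ decode i
  same i i≤ = decodeFuel-irrelevant n (suc i) i
    (≤-<-trans i≤ (m/n<m n 9 (s≤s (s≤s z≤n)))) ≤-refl
  cases : decode n ≡ decodeNode (n % 9) (n / 9)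
  cases with n % 9
  ... | 0 = refl
  ... | 1 = refl
  ... | 2 = refl
  ... | 3 = refl
  ... | 4 = refl
  ... | 5 = cong₂ pairC (same _ (fst≤ (n / 9))) (same _ (snd≤ (n / 9)))
  ... | 6 = cong₂ compC (same _ (fst≤ (n / 9))) (same _ (snd≤ (n / 9)))
  ... | 7 = cong₂ precC (same _ (fst≤ (n / 9))) (same _ (snd≤ (n / 9)))
  ... | suc (suc (suc (suc (suc (suc (suc (suc _))))))) = cong muC (same _ ≤-refl)

godel : ℕ → ℕ → ℕ
godel r p = r + p * 9

godel-%9 : ∀ r p → r < 9 → godel r p % 9 ≡ r
godel-%9 r p r<9 = trans ([m+kn]%n≡m%n r p 9) (m<n⇒m%n≡m r<9)

godel-/9 : ∀ r p → r < 9 → godel r p / 9 ≡ p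
godel-/9 r p r<9 = *-cancelʳ-≡ _ p 9 (+-cancelˡ-≡ r _ _
  (trans (cong (_+ godel r p / 9 * 9) (sym (godel-%9 r p r<9))) (sym (m≡m%n+[m/n]*n (godel r p) 9))))

decode-godel : ∀ r p → r < 9 → decode (godel r p) ≡ decodeNode r p
decode-godel r p r<9 = trans (decode-node (godel r p)) (cong₂ decodeNode (godel-%9 r p r<9) (godel-/9 r p r<9))

encode : Code → ℕ
encode zeroC = godel 0 0
encode succC = godel 1 0
encode idC = godel 2 0
encode fstC = godel 3 0
encode sndC = godel 4 0
encode (pairC c d) = godel 5 (pair (encode c) (encode d))
encode (compC c d) = godel 6 (pair (encode c) (encode d))
encode (precC c d) = godel 7 (pair (encode c) (encode d))
encode (muC c) = godel 8 (encode c)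

decode-fst-snd : ∀ (f : Code → Code → Code) m n →
  f (decode (fst (pair m n))) (decode (snd (pair m n))) ≡ f (decode m) (decode n)
decode-fst-snd f m n = cong₂ (λ a b → f (decode a) (decode b)) (fst-pair m n) (snd-pair m n)

decode-pairC : ∀ m n → decode (godel 5 (pair m n)) ≡ pairC (decode m) (decode n)
decode-pairC m n = trans (decode-godel 5 (pair m n) (<ᵇ⇒< 5 9 _)) (decode-fst-snd pairC m n)

decode-compC : ∀ m n → decode (godel 6 (pair m n)) ≡ compC (decode m) (decode n)
decode-compC m n = trans (decode-godel 6 (pair m n) (<ᵇ⇒< 6 9 _)) (decode-fst-snd compC m n)

decode-precC : ∀ m n → decode (godel 7 (pair m n)) ≡ precC (decode m) (decode n)
decode-precC m n = trans (decode-godel 7 (pair m n) (<ᵇ⇒< 7 9 _)) (decode-fst-snd precC m n)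

decode-encode : ∀ c → decode (encode c) ≡ c
decode-encode zeroC = refl
decode-encode succC = refl
decode-encode idC = refl
decode-encode fstC = refl
decode-encode sndC = refl
decode-encode (pairC c d) = trans (decode-pairC (encode c) (encode d)) (cong₂ pairC (decode-encode c) (decode-encode d))
decode-encode (compC c d) = trans (decode-compC (encode c) (encode d)) (cong₂ compC (decode-encode c) (decode-encode d))
decode-encode (precC c d) = trans (decode-precC (encode c) (encode d)) (cong₂ precC (decode-encode c) (decode-encode d))
decode-encode (muC c) = trans (decode-godel 8 (encode c) (<ᵇ⇒< 8 9 _)) (cong muC (decode-encode c))

-- Computable functions

-- Keeping the code as a tree instead of a Gödel number lets closure properties be proved by
-- combining constructors.
record Comp (f : ℕ → ℕ) : Set where
  constructor comp
  field
    code : Code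
    eval : ∀ x → Eval code x (f x)
open Comp

Comp→Computable : ∀ {f} → Comp f → Computable f
Comp→Computable (comp c ev) = encode c , λ x → subst (λ d → Eval d x _) (sym (decode-encode c)) (ev x)

Computable→Comp : ∀ {f} → Computable f → Comp f
Computable→Comp (e , ev) = comp (decode e) ev

natrec : ℕ → (ℕ → ℕ → ℕ) → ℕ → ℕ
natrec z s zero = z
natrec z s (suc n) = s n (natrec z s n)

ifz : ℕ → ℕ → ℕ → ℕ
ifz zero a b = a
ifz (suc _) a b = b

private
  variable
    f g h z n t x k l d v p e : ℕ → ℕ
    P Q : ℕ → Set

Comp-≗ : (∀ x → f x ≡ g x) → Comp f → Comp g
Comp-≗ eq (comp c ev) = comp c λ x → subst (Eval c x) (eq x) (ev x)

_∘ᶜ_ : Comp f → Comp g → Comp (λ x → f (g x))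
comp c ev ∘ᶜ comp d ev′ = comp (compC c d) λ x → ecomp (ev′ x) (ev _)

idᶜ : Comp (λ x → x)
idᶜ = comp idC λ _ → eid

sucᶜ : Comp f → Comp (λ x → suc (f x))
sucᶜ fᶜ = comp succC (λ _ → esucc) ∘ᶜ fᶜ

constᶜ : ∀ k → Comp (λ _ → k)
constᶜ zero = comp zeroC λ _ → ezero
constᶜ (suc k) = sucᶜ (constᶜ k)

fstᶜ : Comp f → Comp (λ x → fst (f x))
fstᶜ fᶜ = comp fstC (λ _ → efst) ∘ᶜ fᶜ

sndᶜ : Comp f → Comp (λ x → snd (f x))
sndᶜ fᶜ = comp sndC (λ _ → esnd) ∘ᶜ fᶜ

pairᶜ : Comp f → Comp g → Comp (λ x → pair (f x) (g x))
pairᶜ (comp c ev) (comp d ev′) = comp (pairC c d) λ x → epair (ev x) (ev′ x)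

eval-prec : ∀ {s : ℕ → ℕ → ℕ → ℕ} {cz cs} → (∀ x → Eval cz x (z x)) →
  (∀ p → Eval cs p (s (fst p) (fst (snd p)) (snd (snd p)))) →
  ∀ x k → Eval (precC cz cs) (pair x k) (natrec (z x) (s x) k)
eval-prec {z = z} evz evs x zero =
  eprec0 (subst (Eval _ _) (cong z (fst-pair x 0)) (evz _)) (snd-pair x 0)
eval-prec {z = z} {s = s} {cz} {cs} evz evs x (suc k) =
  eprecS (snd-pair x (suc k))
    (subst (λ w → Eval _ (pair w k) r) (sym (fst-pair x (suc k))) (eval-prec evz evs x k))
    (subst (λ w → Eval cs (pair w (pair k r)) (s x k r)) (sym (fst-pair x (suc k)))
      (subst (Eval _ _) unpaired (evs (pair x (pair k r)))))
  where
  r = natrec (z x) (s x) k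
  unpaired : s (fst (pair x (pair k r))) (fst (snd (pair x (pair k r)))) (snd (snd (pair x (pair k r)))) ≡ s x k r
  unpaired rewrite fst-pair x (pair k r) | snd-pair x (pair k r) | fst-pair k r | snd-pair k r = refl

-- The step function gets parameter, index and previous value packed as ⟨x,⟨i,r⟩⟩; `outerᶜ`,
-- `indexᶜ` and `prevᶜ` access the three.
recᶜ : ∀ (s : ℕ → ℕ → ℕ → ℕ) → Comp z → Comp (λ p → s (fst p) (fst (snd p)) (snd (snd p))) →
  Comp n → Comp (λ x → natrec (z x) (s x) (n x))
recᶜ s (comp cz evz) (comp cs evs) (comp cn evn) =
  comp (compC (precC cz cs) (pairC idC cn)) λ x → ecomp (epair eid (evn x)) (eval-prec evz evs x _)

outerᶜ : Comp f → Comp (λ p → f (fst p))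
outerᶜ fᶜ = fᶜ ∘ᶜ fstᶜ idᶜ

indexᶜ : Comp (λ p → fst (snd p))
indexᶜ = fstᶜ (sndᶜ idᶜ)

prevᶜ : Comp (λ p → snd (snd p))
prevᶜ = sndᶜ (sndᶜ idᶜ)

predᶜ : Comp f → Comp (λ x → pred (f x))
predᶜ {f} fᶜ = Comp-≗ (λ x → eq (f x)) (recᶜ (λ _ i _ → i) (constᶜ 0) indexᶜ fᶜ)
  where
  eq : ∀ k → natrec 0 (λ i _ → i) k ≡ pred k
  eq zero = refl
  eq (suc k) = refl

ifzᶜ : Comp t → Comp f → Comp g → Comp (λ x → ifz (t x) (f x) (g x))
ifzᶜ {t} {f} {g} tᶜ fᶜ gᶜ = Comp-≗ (λ x → eq {f x} {g x} (t x)) (recᶜ (λ x _ _ → g x) fᶜ (outerᶜ gᶜ) tᶜ)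
  where
  eq : ∀ {a b} k → natrec a (λ _ _ → b) k ≡ ifz k a b
  eq zero = refl
  eq (suc k) = refl

infixl 6 _+ᶜ_ _∸ᶜ_

_+ᶜ_ : Comp f → Comp g → Comp (λ x → f x + g x)
_+ᶜ_ {f} {g} fᶜ gᶜ = Comp-≗ (λ x → eq {g x} (f x)) (recᶜ (λ _ _ r → suc r) gᶜ (sucᶜ prevᶜ) fᶜ)
  where
  eq : ∀ {b} a → natrec b (λ _ r → suc r) a ≡ a + b
  eq zero = refl
  eq (suc a) = cong suc (eq a)

_∸ᶜ_ : Comp f → Comp g → Comp (λ x → f x ∸ g x)
_∸ᶜ_ {f} {g} fᶜ gᶜ = Comp-≗ (λ x → eq {f x} (g x)) (recᶜ (λ _ _ r → pred r) fᶜ (predᶜ prevᶜ) gᶜ)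
  where
  eq : ∀ {a} b → natrec a (λ _ r → pred r) b ≡ a ∸ b
  eq zero = refl
  eq {a} (suc b) = trans (cong pred (eq b)) (pred[m∸n]≡m∸[1+n] a b)

-- The distance of two numbers, so that 0 stands for truth as in `Π⁰₃`.
neq : ℕ → ℕ → ℕ
neq a b = (a ∸ b) + (b ∸ a)

neq≡0⇒≡ : ∀ a b → neq a b ≡ 0 → a ≡ b
neq≡0⇒≡ a b h = ≤-antisym (m∸n≡0⇒m≤n (m+n≡0⇒m≡0 (a ∸ b) h)) (m∸n≡0⇒m≤n (m+n≡0⇒n≡0 (a ∸ b) h))

≡⇒neq≡0 : ∀ {a b} → a ≡ b → neq a b ≡ 0
≡⇒neq≡0 {a} refl = cong₂ _+_ (n∸n≡0 a) (n∸n≡0 a)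

neqᶜ : Comp f → Comp g → Comp (λ x → neq (f x) (g x))
neqᶜ fᶜ gᶜ = (fᶜ ∸ᶜ gᶜ) +ᶜ (gᶜ ∸ᶜ fᶜ)

-- Division by counting up: the state holds quotient and remainder, and the remainder wraps once it
-- is 8.
nextDivMod9 : ℕ → ℕ
nextDivMod9 s = ifz (8 ∸ snd s) (pair (suc (fst s)) 0) (pair (fst s) (suc (snd s)))

divMod9 : ∀ n → natrec 0 (λ _ → nextDivMod9) n ≡ pair (n / 9) (n % 9)
divMod9 zero = refl
divMod9 (suc n) rewrite divMod9 n | fst-pair (n / 9) (n % 9) | snd-pair (n / 9) (n % 9)
  with 8 ∸ n % 9 in eq
... | zero = trans (sym (cong₂ pair (godel-/9 0 (suc (n / 9)) (<ᵇ⇒< 0 9 _)) (godel-%9 0 (suc (n / 9)) (<ᵇ⇒< 0 9 _))))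
    (cong (λ k → pair (k / 9) (k % 9)) (sym (trans (cong suc (m≡m%n+[m/n]*n n 9)) (cong (λ r → godel (suc r) (n / 9)) n%9≡8))))
  where
  n%9≡8 : n % 9 ≡ 8
  n%9≡8 = ≤-antisym (s≤s⁻¹ (m%n<n n 9)) (m∸n≡0⇒m≤n eq)
... | suc d = trans (sym (cong₂ pair (godel-/9 (suc (n % 9)) (n / 9) sr<9) (godel-%9 (suc (n % 9)) (n / 9) sr<9)))
    (cong (λ k → pair (k / 9) (k % 9)) (sym (cong suc (m≡m%n+[m/n]*n n 9))))
  where
  sr<9 : suc (n % 9) < 9
  sr<9 = s≤s (m∸n≢0⇒n<m λ p → 1+n≢0 (trans (sym eq) p))

divMod9ᶜ : Comp f → Comp (λ x → pair (f x / 9) (f x % 9))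
divMod9ᶜ {f} fᶜ = Comp-≗ (λ x → divMod9 (f x))
  (recᶜ (λ _ _ → nextDivMod9) (constᶜ 0)
    (ifzᶜ (constᶜ 8 ∸ᶜ sndᶜ prevᶜ) (pairᶜ (sucᶜ (fstᶜ prevᶜ)) (constᶜ 0)) (pairᶜ (fstᶜ prevᶜ) (sucᶜ (sndᶜ prevᶜ))))
    fᶜ)

/9ᶜ : Comp f → Comp (λ x → f x / 9)
/9ᶜ {f} fᶜ = Comp-≗ (λ x → fst-pair (f x / 9) (f x % 9)) (fstᶜ (divMod9ᶜ fᶜ))

%9ᶜ : Comp f → Comp (λ x → f x % 9)
%9ᶜ {f} fᶜ = Comp-≗ (λ x → snd-pair (f x / 9) (f x % 9)) (sndᶜ (divMod9ᶜ fᶜ))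

godelᶜ : ∀ r → Comp f → Comp (λ x → godel r (f x))
godelᶜ {f} r fᶜ = constᶜ r +ᶜ Comp-≗ (λ x → eq (f x)) (recᶜ (λ _ _ s → 9 + s) (constᶜ 0) (constᶜ 9 +ᶜ prevᶜ) fᶜ)
  where
  eq : ∀ k → natrec 0 (λ _ s → 9 + s) k ≡ k * 9
  eq zero = refl
  eq (suc k) = cong (9 +_) (eq k)

-- A universal machine

-- A stack machine on numbers. States with tag 0 evaluate a code, those with tag 1 return a value to
-- the stack. The empty stack is 0 and frames have tags 1 to 5: left component pending, left
-- component known, composition, recursion, search.
push : ℕ → ℕ → ℕ → ℕ
push tag d K = pair tag (pair d K)

evState : ℕ → ℕ → ℕ → ℕ
evState n x K = pair 0 (pair n (pair x K))

retState : ℕ → ℕ → ℕ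
retState v K = pair 1 (pair v K)

evNode : ℕ → ℕ → ℕ → ℕ → ℕ → ℕ
evNode t p n x K =
  ifz t (retState 0 K)
  (ifz (t ∸ 1) (retState (suc x) K)
  (ifz (t ∸ 2) (retState x K)
  (ifz (t ∸ 3) (retState (fst x) K)
  (ifz (t ∸ 4) (retState (snd x) K)
  (ifz (t ∸ 5) (evState (fst p) x (push 1 (pair (snd p) x) K))
  (ifz (t ∸ 6) (evState (snd p) x (push 3 (fst p) K))
  (ifz (t ∸ 7) (ifz (snd x) (evState (fst p) (fst x) K)
                 (evState n (pair (fst x) (pred (snd x)))
                   (push 4 (pair (snd p) (pair (fst x) (pred (snd x)))) K)))
    (evState p (pair x 0) (push 5 (pair p (pair x 0)) K)))))))))

evStep : ℕ → ℕ → ℕ → ℕ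
evStep n x K = evNode (n % 9) (n / 9) n x K

retFrame : ℕ → ℕ → ℕ → ℕ → ℕ → ℕ
retFrame t d v K L =
  -- Tag 0 means the empty stack, since `fst 0` is 0. The whole stack `L` is put back, so a halted
  -- state is a fixed point.
  ifz t (retState v L)
  (ifz (t ∸ 1) (evState (fst d) (snd d) (push 2 v K))
  (ifz (t ∸ 2) (retState (pair d v) K)
  (ifz (t ∸ 3) (evState d v K)
  (ifz (t ∸ 4) (evState (fst d) (pair (fst (snd d)) (pair (snd (snd d)) v)) K)
    (ifz v (retState (snd (snd d)) K)
      (evState (fst d) (pair (fst (snd d)) (suc (snd (snd d))))
        (push 5 (pair (fst d) (pair (fst (snd d)) (suc (snd (snd d))))) K)))))))

retStep : ℕ → ℕ → ℕ
retStep v K = retFrame (fst K) (fst (snd K)) v (snd (snd K)) K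

machineStep : ℕ → ℕ
machineStep s = ifz (fst s)
  (evStep (fst (snd s)) (fst (snd (snd s))) (snd (snd (snd s))))
  (retStep (fst (snd s)) (snd (snd s)))

pushᶜ : Comp t → Comp d → Comp k → Comp (λ w → push (t w) (d w) (k w))
pushᶜ t d k = pairᶜ t (pairᶜ d k)

evStateᶜ : Comp n → Comp x → Comp k → Comp (λ w → evState (n w) (x w) (k w))
evStateᶜ n x k = pairᶜ (constᶜ 0) (pairᶜ n (pairᶜ x k))

retStateᶜ : Comp v → Comp k → Comp (λ w → retState (v w) (k w))
retStateᶜ v k = pairᶜ (constᶜ 1) (pairᶜ v k)

evNodeᶜ : Comp t → Comp p → Comp n → Comp x → Comp k →
  Comp (λ w → evNode (t w) (p w) (n w) (x w) (k w))
evNodeᶜ t p n x k =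
  ifzᶜ t (retStateᶜ (constᶜ 0) k)
  (ifzᶜ (t ∸ᶜ constᶜ 1) (retStateᶜ (sucᶜ x) k)
  (ifzᶜ (t ∸ᶜ constᶜ 2) (retStateᶜ x k)
  (ifzᶜ (t ∸ᶜ constᶜ 3) (retStateᶜ (fstᶜ x) k)
  (ifzᶜ (t ∸ᶜ constᶜ 4) (retStateᶜ (sndᶜ x) k)
  (ifzᶜ (t ∸ᶜ constᶜ 5) (evStateᶜ (fstᶜ p) x (pushᶜ (constᶜ 1) (pairᶜ (sndᶜ p) x) k))
  (ifzᶜ (t ∸ᶜ constᶜ 6) (evStateᶜ (sndᶜ p) x (pushᶜ (constᶜ 3) (fstᶜ p) k))
  (ifzᶜ (t ∸ᶜ constᶜ 7) (ifzᶜ (sndᶜ x) (evStateᶜ (fstᶜ p) (fstᶜ x) k)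
      (evStateᶜ n below (pushᶜ (constᶜ 4) (pairᶜ (sndᶜ p) below) k)))
    (evStateᶜ p start (pushᶜ (constᶜ 5) (pairᶜ p start) k)))))))))
  where
  below = pairᶜ (fstᶜ x) (predᶜ (sndᶜ x))
  start = pairᶜ x (constᶜ 0)

evStepᶜ : Comp n → Comp x → Comp k → Comp (λ w → evStep (n w) (x w) (k w))
evStepᶜ n x k = evNodeᶜ (%9ᶜ n) (/9ᶜ n) n x k

retFrameᶜ : Comp t → Comp d → Comp v → Comp k → Comp l →
  Comp (λ w → retFrame (t w) (d w) (v w) (k w) (l w))
retFrameᶜ t d v k l =
  ifzᶜ t (retStateᶜ v l)
  (ifzᶜ (t ∸ᶜ constᶜ 1) (evStateᶜ (fstᶜ d) (sndᶜ d) (pushᶜ (constᶜ 2) v k))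
  (ifzᶜ (t ∸ᶜ constᶜ 2) (retStateᶜ (pairᶜ d v) k)
  (ifzᶜ (t ∸ᶜ constᶜ 3) (evStateᶜ d v k)
  (ifzᶜ (t ∸ᶜ constᶜ 4) (evStateᶜ (fstᶜ d) (pairᶜ (fstᶜ (sndᶜ d)) (pairᶜ (sndᶜ (sndᶜ d)) v)) k)
    (ifzᶜ v (retStateᶜ (sndᶜ (sndᶜ d)) k)
      (evStateᶜ (fstᶜ d) next (pushᶜ (constᶜ 5) (pairᶜ (fstᶜ d) next) k)))))))
  where
  next = pairᶜ (fstᶜ (sndᶜ d)) (sucᶜ (sndᶜ (sndᶜ d)))

retStepᶜ : Comp v → Comp k → Comp (λ w → retStep (v w) (k w))
retStepᶜ v k = retFrameᶜ (fstᶜ k) (fstᶜ (sndᶜ k)) v (sndᶜ (sndᶜ k)) k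

machineStepᶜ : Comp f → Comp (λ w → machineStep (f w))
machineStepᶜ s = ifzᶜ (fstᶜ s)
  (evStepᶜ (fstᶜ (sndᶜ s)) (fstᶜ (sndᶜ (sndᶜ s))) (sndᶜ (sndᶜ (sndᶜ s))))
  (retStepᶜ (fstᶜ (sndᶜ s)) (sndᶜ (sndᶜ s)))

machine : ℕ → ℕ → ℕ
machine s = natrec s (λ _ → machineStep)

-- run e x s is suc y once the machine has returned y to the empty stack within s steps, and 0 before.
readout : ℕ → ℕ
readout s = ifz (fst s) 0 (ifz (snd (snd s)) (suc (fst (snd s))) 0)

opaque
  run : ℕ → ℕ → ℕ → ℕ
  run e x s = readout (machine (evState e x 0) s)

  runᶜ : Comp e → Comp x → Comp t → Comp (λ w → run (e w) (x w) (t w))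
  runᶜ {e} {x} {t} eᶜ xᶜ tᶜ = ifzᶜ (fstᶜ m) (constᶜ 0) (ifzᶜ (sndᶜ (sndᶜ m)) (sucᶜ (fstᶜ (sndᶜ m))) (constᶜ 0))
    where
    m : Comp (λ w → machine (evState (e w) (x w) 0) (t w))
    m = recᶜ (λ _ _ → machineStep) (evStateᶜ eᶜ xᶜ (constᶜ 0)) (machineStepᶜ prevᶜ) tᶜ

-- The abstract machine behind the numeric one, and completeness

data Frame : Set where
  pairL : ℕ → ℕ → Frame
  pairR : ℕ → Frame
  compK : ℕ → Frame
  precK : ℕ → ℕ → ℕ → Frame
  muK   : ℕ → ℕ → ℕ → Frame

Stack : Set
Stack = List Frame

data State : Set where
  ev  : ℕ → ℕ → Stack → State
  ret : ℕ → Stack → State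

stackCode : Stack → ℕ
stackCode [] = 0
stackCode (pairL g x ∷ K) = push 1 (pair g x) (stackCode K)
stackCode (pairR y ∷ K) = push 2 y (stackCode K)
stackCode (compK f ∷ K) = push 3 f (stackCode K)
stackCode (precK g a n ∷ K) = push 4 (pair g (pair a n)) (stackCode K)
stackCode (muK f x n ∷ K) = push 5 (pair f (pair x n)) (stackCode K)

stateCode : State → ℕ
stateCode (ev n x K) = evState n x (stackCode K)
stateCode (ret v K) = retState v (stackCode K)

precStep : ℕ → ℕ → ℕ → ℕ → Stack → State
precStep zero    p n a K = ev (fst p) a K
precStep (suc m) p n a K = ev n (pair a m) (precK (snd p) a m ∷ K)

nodeStep : ℕ → ℕ → ℕ → ℕ → Stack → State
nodeStep 0 p n x K = ret 0 K
nodeStep 1 p n x K = ret (suc x) K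
nodeStep 2 p n x K = ret x K
nodeStep 3 p n x K = ret (fst x) K
nodeStep 4 p n x K = ret (snd x) K
nodeStep 5 p n x K = ev (fst p) x (pairL (snd p) x ∷ K)
nodeStep 6 p n x K = ev (snd p) x (compK (fst p) ∷ K)
nodeStep 7 p n x K = precStep (snd x) p n (fst x) K
nodeStep (suc (suc (suc (suc (suc (suc (suc (suc _)))))))) p n x K = ev p (pair x 0) (muK p x 0 ∷ K)

frameStep : Frame → ℕ → Stack → State
frameStep (pairL g x) v K = ev g x (pairR v ∷ K)
frameStep (pairR y) v K = ret (pair y v) K
frameStep (compK f) v K = ev f v K
frameStep (precK g a n) v K = ev g (pair a (pair n v)) K
frameStep (muK f x n) zero K = ret n K
frameStep (muK f x n) (suc _) K = ev f (pair x (suc n)) (muK f x (suc n) ∷ K)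

next : State → State
next (ev n x K) = nodeStep (n % 9) (n / 9) n x K
next (ret v []) = ret v []
next (ret v (F ∷ K)) = frameStep F v K

evNode-code : ∀ t p n x K → evNode t p n x (stackCode K) ≡ stateCode (nodeStep t p n x K)
evNode-code 0 p n x K = refl
evNode-code 1 p n x K = refl
evNode-code 2 p n x K = refl
evNode-code 3 p n x K = refl
evNode-code 4 p n x K = refl
evNode-code 5 p n x K = refl
evNode-code 6 p n x K = refl
evNode-code 7 p n x K with snd x
... | zero = refl
... | suc m = refl
evNode-code (suc (suc (suc (suc (suc (suc (suc (suc _)))))))) p n x K = refl

retStep-push : ∀ t d v k → retStep v (push t d k) ≡ retFrame t d v k (push t d k)
retStep-push t d v k
  rewrite fst-pair t (pair d k) | snd-pair t (pair d k) | fst-pair d k | snd-pair d k = refl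

frame-code : ∀ F v K → retStep v (stackCode (F ∷ K)) ≡ stateCode (frameStep F v K)
frame-code (pairL g x) v K = trans (retStep-push 1 (pair g x) v (stackCode K)) eq
  where
  eq : retFrame 1 (pair g x) v (stackCode K) (push 1 (pair g x) (stackCode K)) ≡ stateCode (frameStep (pairL g x) v K)
  eq rewrite fst-pair g x | snd-pair g x = refl
frame-code (pairR y) v K = retStep-push 2 y v (stackCode K)
frame-code (compK f) v K = retStep-push 3 f v (stackCode K)
frame-code (precK g a n) v K = trans (retStep-push 4 (pair g (pair a n)) v (stackCode K)) eq
  where
  eq : retFrame 4 (pair g (pair a n)) v (stackCode K) (push 4 (pair g (pair a n)) (stackCode K)) ≡ stateCode (frameStep (precK g a n) v K)
  eq rewrite fst-pair g (pair a n) | snd-pair g (pair a n) | fst-pair a n | snd-pair a n = refl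
frame-code (muK f x n) v K = trans (retStep-push 5 (pair f (pair x n)) v (stackCode K)) (eq v)
  where
  eq : ∀ v → retFrame 5 (pair f (pair x n)) v (stackCode K) (push 5 (pair f (pair x n)) (stackCode K)) ≡ stateCode (frameStep (muK f x n) v K)
  eq v rewrite fst-pair f (pair x n) | snd-pair f (pair x n) | fst-pair x n | snd-pair x n with v
  ... | zero = refl
  ... | suc _ = refl

machineStep-ev : ∀ n x k → machineStep (evState n x k) ≡ evStep n x k
machineStep-ev n x k
  rewrite fst-pair 0 (pair n (pair x k)) | snd-pair 0 (pair n (pair x k))
        | fst-pair n (pair x k) | snd-pair n (pair x k) | fst-pair x k | snd-pair x k = refl

machineStep-ret : ∀ v k → machineStep (retState v k) ≡ retStep v k
machineStep-ret v k
  rewrite fst-pair 1 (pair v k) | snd-pair 1 (pair v k) | fst-pair v k | snd-pair v k = refl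

machineStep-code : ∀ σ → machineStep (stateCode σ) ≡ stateCode (next σ)
machineStep-code (ev n x K) = trans (machineStep-ev n x (stackCode K)) (evNode-code (n % 9) (n / 9) n x K)
machineStep-code (ret v []) = machineStep-ret v 0
machineStep-code (ret v (F ∷ K)) = trans (machineStep-ret v (stackCode (F ∷ K))) (frame-code F v K)

steps : ℕ → State → State
steps zero σ = σ
steps (suc s) σ = next (steps s σ)

machine-code : ∀ s σ → machine (stateCode σ) s ≡ stateCode (steps s σ)
machine-code zero σ = refl
machine-code (suc s) σ = trans (cong machineStep (machine-code s σ)) (machineStep-code (steps s σ))

steps-+ : ∀ s t σ → steps (s + t) σ ≡ steps s (steps t σ)
steps-+ zero t σ = refl
steps-+ (suc s) t σ = cong next (steps-+ s t σ)

Reaches : State → State → Set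
Reaches σ τ = ∃ λ s → steps s σ ≡ τ

reaches-refl : ∀ {σ} → Reaches σ σ
reaches-refl = 0 , refl

_then_ : ∀ {σ τ ρ} → Reaches σ τ → Reaches τ ρ → Reaches σ ρ
(s , refl) then (t , refl) = t + s , steps-+ t s _

after : ∀ {σ τ} → Reaches (next σ) τ → Reaches σ τ
after = (1 , refl) then_

mutual
  -- Induction on the derivation, for all stacks at once. The code is a variable with equations so
  -- that the derivation can be matched once the tag is known; `c ≡ decode n` is kept because
  -- primitive recursion evaluates `n` again.
  reaches-ev : ∀ n {c x y} K → c ≡ decode n → Eval c x y → Reaches (ev n x K) (ret y K)
  reaches-ev n K eq d = after (reaches-node (n % 9) (n / 9) n K eq (trans eq (decode-node n)) d)

  reaches-node : ∀ t p n {c x y} K → c ≡ decode n → c ≡ decodeNode t p → Eval c x y →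
    Reaches (nodeStep t p n x K) (ret y K)
  reaches-node 0 p n K eq refl ezero = reaches-refl
  reaches-node 1 p n K eq refl esucc = reaches-refl
  reaches-node 2 p n K eq refl eid = reaches-refl
  reaches-node 3 p n K eq refl efst = reaches-refl
  reaches-node 4 p n K eq refl esnd = reaches-refl
  reaches-node 5 p n K eq refl (epair d e) =
    reaches-ev (fst p) _ refl d then after (reaches-ev (snd p) _ refl e then after reaches-refl)
  reaches-node 6 p n K eq refl (ecomp d e) =
    reaches-ev (snd p) _ refl d then after (reaches-ev (fst p) K refl e)
  reaches-node 7 p n K eq refl (eprec0 {x = x} d s≡0) rewrite s≡0 = reaches-ev (fst p) K refl d
  reaches-node 7 p n K eq refl (eprecS s≡suc d e) rewrite s≡suc =
    reaches-ev n _ eq d then after (reaches-ev (snd p) K refl e)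
  reaches-node (suc (suc (suc (suc (suc (suc (suc (suc _)))))))) p n K eq refl (emu {x = x} {n = m} d before) =
    search m ≤-refl then (reaches-ev p _ refl d then after reaches-refl)
    where
    -- All values below `m` are positive, so the frame `muK` advances through them one candidate at
    -- a time.
    search : ∀ i → i ≤ m → Reaches (ev p (pair x 0) (muK p x 0 ∷ K)) (ev p (pair x i) (muK p x i ∷ K))
    search zero _ = reaches-refl
    search (suc i) i<m = search i (<⇒≤ i<m) then
      (reaches-ev p _ refl (proj₂ (before i i<m)) then after reaches-refl)

-- Soundness of the machine by denotations

MuFrom : ℕ → ℕ → ℕ → ℕ → Set
MuFrom f x n m = Eval (decode f) (pair x m) 0 × n ≤ m ×
  (∀ i → n ≤ i → i < m → Σ ℕ λ v → Eval (decode f) (pair x i) (suc v))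

-- A frame denotes a relation between the value it receives and the value it hands to the rest of
-- the stack; thereby a state denotes its possible final answers.
FrameDen : Frame → ℕ → ℕ → Set
FrameDen (pairL g x) v w = ∃ λ z → Eval (decode g) x z × pair v z ≡ w
FrameDen (pairR y) v w = pair y v ≡ w
FrameDen (compK f) v w = Eval (decode f) v w
FrameDen (precK g a n) v w = Eval (decode g) (pair a (pair n v)) w
FrameDen (muK f x n) zero w = n ≡ w
FrameDen (muK f x n) (suc _) w = MuFrom f x (suc n) w

StackDen : Stack → ℕ → ℕ → Set
StackDen [] v y = v ≡ y
StackDen (F ∷ K) v y = ∃ λ w → FrameDen F v w × StackDen K w y

Den : State → ℕ → Set
Den (ev n x K) y = ∃ λ v → Eval (decode n) x v × StackDen K v y
Den (ret v K) y = StackDen K v y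

nodeStep-den : ∀ t p n x K {y} → decode n ≡ decodeNode t p → Den (nodeStep t p n x K) y →
  ∃ λ v → Eval (decodeNode t p) x v × StackDen K v y
nodeStep-den 0 p n x K eq d = _ , ezero , d
nodeStep-den 1 p n x K eq d = _ , esucc , d
nodeStep-den 2 p n x K eq d = _ , eid , d
nodeStep-den 3 p n x K eq d = _ , efst , d
nodeStep-den 4 p n x K eq d = _ , esnd , d
nodeStep-den 5 p n x K eq (v , d , _ , (z , e , refl) , k) = _ , epair d e , k
nodeStep-den 6 p n x K eq (v , d , w , e , k) = w , ecomp d e , k
nodeStep-den 7 p n x K eq den with snd x in s
nodeStep-den 7 p n x K eq (v , d , k) | zero = v , eprec0 d s , k
nodeStep-den 7 p n x K eq (v , d , w , e , k) | suc m =
  w , eprecS s (subst (λ c → Eval c _ v) eq d) e , k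
nodeStep-den (suc (suc (suc (suc (suc (suc (suc (suc _)))))))) p n x K eq (zero , d , _ , refl , k) =
  0 , emu d (λ _ ()) , k
nodeStep-den (suc (suc (suc (suc (suc (suc (suc (suc _)))))))) p n x K eq (suc v , d , w , (e , _ , before) , k) =
  -- The frame vouches for candidates from 1 on; candidate 0 is the positive value just returned.
  w , emu e (λ { zero _ → v , d ; (suc i) i<w → before (suc i) (s≤s z≤n) i<w }) , k

frameStep-den : ∀ F v K {y} → Den (frameStep F v K) y → ∃ λ w → FrameDen F v w × StackDen K w y
frameStep-den (pairL g x) v K (z , d , _ , refl , k) = _ , (z , d , refl) , k
frameStep-den (pairR u) v K d = _ , refl , d
frameStep-den (compK f) v K d = d
frameStep-den (precK g a n) v K d = d
frameStep-den (muK f x n) zero K d = _ , refl , d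
frameStep-den (muK f x n) (suc _) K (zero , d , w , refl , k) =
  w , (d , ≤-refl , λ i n<i i<n → contradiction i<n (≤⇒≯ n<i)) , k
frameStep-den (muK f x n) (suc _) K (suc v , d , w , (e , n<w , before) , k) =
  w , (e , <⇒≤ n<w , before′) , k
  where
  before′ : ∀ i → suc n ≤ i → i < w → Σ ℕ λ v → Eval (decode f) (pair x i) (suc v)
  before′ i n<i i<w with m≤n⇒m<n∨m≡n n<i
  ... | inj₁ sn<i = before i sn<i i<w
  ... | inj₂ refl = v , d

-- Denotations pull back along a step. A halted state denotes its value, hence so does the initial
-- state it came from.
next-den : ∀ σ {y} → Den (next σ) y → Den σ y
next-den (ev n x K) {y} d =
  subst (λ c → ∃ λ v → Eval c x v × StackDen K v y) (sym (decode-node n))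
    (nodeStep-den (n % 9) (n / 9) n x K (decode-node n) d)
next-den (ret v []) d = d
next-den (ret v (F ∷ K)) d = frameStep-den F v K d

steps-den : ∀ s σ {y} → Den (steps s σ) y → Den σ y
steps-den zero σ d = d
steps-den (suc s) σ d = steps-den s σ (next-den (steps s σ) d)

readout-ret : ∀ v k → readout (retState v k) ≡ ifz k (suc v) 0
readout-ret v k
  rewrite fst-pair 1 (pair v k) | snd-pair 1 (pair v k) | fst-pair v k | snd-pair v k = refl

readout-frame : ∀ F K v → ifz (stackCode (F ∷ K)) (suc v) 0 ≡ 0
readout-frame (pairL _ _) K v = refl
readout-frame (pairR _) K v = refl
readout-frame (compK _) K v = refl
readout-frame (precK _ _ _) K v = refl
readout-frame (muK _ _ _) K v = refl

readout-den : ∀ σ {y} → readout (stateCode σ) ≡ suc y → Den σ y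
readout-den (ev n x K) h rewrite fst-pair 0 (pair n (pair x (stackCode K))) = contradiction (sym h) 1+n≢0
readout-den (ret v []) h = suc-injective (trans (sym (readout-ret v 0)) h)
readout-den (ret v (F ∷ K)) h =
  contradiction (trans (sym h) (trans (readout-ret v (stackCode (F ∷ K))) (readout-frame F K v))) 1+n≢0

opaque
  unfolding run

  run-sound : ∀ e x s {y} → run e x s ≡ suc y → Φ e x y
  run-sound e x s h with steps-den s (ev e x []) (readout-den (steps s (ev e x [])) (trans (sym (cong readout (machine-code s (ev e x [])))) h))
  ... | _ , d , refl = d

  run-complete : ∀ e x {y} → Φ e x y → ∃ λ s → run e x s ≡ suc y
  run-complete e x {y} d with reaches-ev e [] refl d
  ... | s , eq = s , trans (cong readout (trans (machine-code s (ev e x [])) (cong stateCode eq))) (readout-ret y 0)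

Eval-functional : ∀ {c x y z} → Eval c x y → Eval c x z → y ≡ z
Eval-functional ezero ezero = refl
Eval-functional esucc esucc = refl
Eval-functional eid eid = refl
Eval-functional efst efst = refl
Eval-functional esnd esnd = refl
Eval-functional (epair d e) (epair d′ e′) = cong₂ pair (Eval-functional d d′) (Eval-functional e e′)
Eval-functional (ecomp d e) (ecomp d′ e′) with Eval-functional d d′
... | refl = Eval-functional e e′
Eval-functional (eprec0 d _) (eprec0 d′ _) = Eval-functional d d′
Eval-functional (eprec0 _ s) (eprecS s′ _ _) = contradiction (trans (sym s′) s) 1+n≢0
Eval-functional (eprecS s _ _) (eprec0 _ s′) = contradiction (trans (sym s) s′) 1+n≢0
Eval-functional (eprecS s d e) (eprecS s′ d′ e′) with suc-injective (trans (sym s) s′)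
... | refl with Eval-functional d d′
... | refl = Eval-functional e e′
Eval-functional (emu {n = m} d before) (emu {n = n} d′ before′) with <-cmp m n
... | tri< m<n _ _ = contradiction (Eval-functional (proj₂ (before′ m m<n)) d) 1+n≢0
... | tri≈ _ m≡n _ = m≡n
... | tri> _ _ n<m = contradiction (Eval-functional (proj₂ (before n n<m)) d′) 1+n≢0

-- Semidecidable predicates

-- Σ⁰₁ predicates in normal form: some witness makes a computable test vanish.
record Semi (P : ℕ → Set) : Set where
  constructor semi
  field
    test     : ℕ → ℕ → ℕ
    testᶜ    : Comp (λ p → test (fst p) (snd p))
    sound    : ∀ x w → test x w ≡ 0 → P x
    complete : ∀ x → P x → ∃ λ w → test x w ≡ 0
open Semi

dec-semi : Comp f → (∀ x → f x ≡ 0 → P x) → (∀ x → P x → f x ≡ 0) → Semi P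
dec-semi {f} fᶜ s c = semi (λ x _ → f x) (outerᶜ fᶜ) (λ x _ → s x) (λ x p → 0 , c x p)

≡ˢ : Comp f → Comp g → Semi (λ x → f x ≡ g x)
≡ˢ {f} {g} fᶜ gᶜ = dec-semi (neqᶜ fᶜ gᶜ) (λ x → neq≡0⇒≡ (f x) (g x)) (λ x → ≡⇒neq≡0)

test-at : (S : Semi P) → Comp f → Comp g → Comp (λ x → test S (f x) (g x))
test-at {f = f} {g} S fᶜ gᶜ =
  Comp-≗ (λ x → cong₂ (test S) (fst-pair (f x) (g x)) (snd-pair (f x) (g x))) (testᶜ S ∘ᶜ pairᶜ fᶜ gᶜ)

_×ˢ_ : Semi P → Semi Q → Semi (λ x → P x × Q x)
S ×ˢ T = semi (λ x w → test S x (fst w) + test T x (snd w))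
  (test-at S (fstᶜ idᶜ) (fstᶜ (sndᶜ idᶜ)) +ᶜ test-at T (fstᶜ idᶜ) (sndᶜ (sndᶜ idᶜ)))
  (λ x w h → sound S x (fst w) (m+n≡0⇒m≡0 _ h) , sound T x (snd w) (m+n≡0⇒n≡0 (test S x (fst w)) h))
  λ x (p , q) → let (u , hu) = complete S x p ; (v , hv) = complete T x q in
    pair u v , cong₂ _+_ (trans (cong (test S x) (fst-pair u v)) hu) (trans (cong (test T x) (snd-pair u v)) hv)

∃ˢ : (P : ℕ → ℕ → Set) → Semi (λ p → P (fst p) (snd p)) → Semi (λ x → ∃ (P x))
∃ˢ P S = semi (λ x w → test S (pair x (fst w)) (snd w))
  (test-at S (pairᶜ (fstᶜ idᶜ) (fstᶜ (sndᶜ idᶜ))) (sndᶜ (sndᶜ idᶜ)))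
  (λ x w h → fst w , subst₂ P (fst-pair x (fst w)) (snd-pair x (fst w)) (sound S _ _ h))
  λ x (y , p) → let (w , h) = complete S (pair x y) (subst₂ P (sym (fst-pair x y)) (sym (snd-pair x y)) p) in
    pair y w , trans (cong₂ (λ a b → test S (pair x a) b) (fst-pair y w) (snd-pair y w)) h

Φˢ : Comp e → Comp x → Comp v → Semi (λ w → Φ (e w) (x w) (v w))
Φˢ {e} {x} {v} eᶜ xᶜ vᶜ = semi (λ w s → neq (run (e w) (x w) s) (suc (v w)))
  (neqᶜ (runᶜ (outerᶜ eᶜ) (outerᶜ xᶜ) (sndᶜ idᶜ)) (sucᶜ (outerᶜ vᶜ)))
  (λ w s h → run-sound (e w) (x w) s (neq≡0⇒≡ _ _ h))
  (λ w d → let (s , h) = run-complete (e w) (x w) d in s , ≡⇒neq≡0 h)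

-- The generated equivalence relation as path connectivity

Edge : ℕ → ℕ → ℕ → Set
Edge z a b = W z (pair a b) ⊎ W z (pair b a)

-- Edges are symmetric, so reversing a path accounts for `rsym`. Unlike derivations, paths are
-- easily coded by numbers.
R→Star : ∀ {z a b} → R z a b → Star (Edge z) a b
R→Star (gen w) = inj₁ w ◅ ε
R→Star rrefl = ε
R→Star (rsym r) = reverse [ inj₂ , inj₁ ]′ (R→Star r)
R→Star (rtrans r r′) = R→Star r ◅◅ R→Star r′

Edge→R : ∀ {z a b} → Edge z a b → R z a b
Edge→R (inj₁ w) = gen w
Edge→R (inj₂ w) = rsym (gen w)

-- A path is coded by the list of its successive vertices, each with a time bound
-- for the edge leading to it; an instruction whose edge is not confirmed is skipped.
edgeTest : ℕ → ℕ → ℕ → ℕ → ℕ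
edgeTest z a b s = run z (pair a b) s + run z (pair b a) s

pathStep : ℕ → ℕ → ℕ
pathStep z s = pair
  (ifz (edgeTest z (fst s) (fst (fst (snd s))) (snd (fst (snd s)))) (fst s) (fst (fst (snd s))))
  (snd (snd s))

follow : ℕ → ℕ → ℕ → ℕ
follow z s = natrec s (λ _ → pathStep z)

pathStepᶜ : Comp z → Comp f → Comp (λ w → pathStep (z w) (f w))
pathStepᶜ zᶜ fᶜ = pairᶜ (ifzᶜ (runᶜ zᶜ (pairᶜ a b) s +ᶜ runᶜ zᶜ (pairᶜ b a) s) a b) (sndᶜ (sndᶜ fᶜ))
  where
  a = fstᶜ fᶜ
  b = fstᶜ (fstᶜ (sndᶜ fᶜ))
  s = sndᶜ (fstᶜ (sndᶜ fᶜ))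

edgeTest-sound : ∀ z a b s {i} → edgeTest z a b s ≡ suc i → Edge z a b
edgeTest-sound z a b s h with run z (pair a b) s in eq
... | suc v = inj₁ (v , run-sound z (pair a b) s eq)
... | zero = inj₂ (_ , run-sound z (pair b a) s h)

edgeTest-complete : ∀ z a b → Edge z a b → ∃ λ s → ∃ λ i → edgeTest z a b s ≡ suc i
edgeTest-complete z a b (inj₁ (y , d)) = let (s , h) = run-complete z (pair a b) d in
  s , _ , cong (_+ run z (pair b a) s) h
edgeTest-complete z a b (inj₂ (y , d)) = let (s , h) = run-complete z (pair b a) d in
  s , _ , trans (cong (run z (pair a b) s +_) h) (+-suc _ y)

pathStep-R : ∀ z s → R z (fst s) (fst (pathStep z s))
pathStep-R z s = subst (R z (fst s)) (sym (fst-pair (ifz found a b) (snd (snd s)))) r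
  where
  a = fst s
  b = fst (fst (snd s))
  found = edgeTest z a b (snd (fst (snd s)))
  r : R z a (ifz found a b)
  r with found in eq
  ... | zero = rrefl
  ... | suc _ = Edge→R (edgeTest-sound z a b (snd (fst (snd s))) eq)

-- Any number is a sound list of instructions: unconfirmed moves are skipped, so the current vertex
-- never leaves its class.
follow-R : ∀ z s n → R z (fst s) (fst (follow z s n))
follow-R z s zero = rrefl
follow-R z s (suc n) = rtrans (follow-R z s n) (pathStep-R z (follow z s n))

-- `natrec` adds steps at the end, whereas a path is consumed from the front.
follow-suc : ∀ z s n → follow z s (suc n) ≡ follow z (pathStep z s) n
follow-suc z s zero = refl
follow-suc z s (suc n) = cong (pathStep z) (follow-suc z s n)

pathStep-edge : ∀ z a b s l {i} → edgeTest z a b s ≡ suc i →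
  pathStep z (pair a (pair (pair b s) l)) ≡ pair b l
pathStep-edge z a b s l h
  rewrite fst-pair a (pair (pair b s) l) | snd-pair a (pair (pair b s) l)
        | fst-pair (pair b s) l | snd-pair (pair b s) l | fst-pair b s | snd-pair b s | h = refl

Star→follow : ∀ {z a b} → Star (Edge z) a b → ∃ λ l → ∃ λ n → fst (follow z (pair a l) n) ≡ b
Star→follow {a = a} ε = 0 , 0 , fst-pair a 0
Star→follow {z} {a} (_◅_ {j = b} e es) =
  let (s , _ , h) = edgeTest-complete z a b e
      (l , n , eq) = Star→follow es
  in pair (pair b s) l , suc n ,
     trans (cong fst (trans (follow-suc z _ n) (cong (λ q → follow z q n) (pathStep-edge z a b s l h)))) eq

Rˢ : Comp z → Comp x → Comp v → Semi (λ w → R (z w) (x w) (v w))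
Rˢ {z} {x} {v} zᶜ xᶜ vᶜ = semi
  -- The witness `q` pairs a list of instructions with the number of them to follow.
  (λ w q → neq (fst (follow (z w) (pair (x w) (fst q)) (snd q))) (v w))
  (neqᶜ (fstᶜ (recᶜ (λ p _ → pathStep (z (fst p)))
      (pairᶜ (outerᶜ xᶜ) (fstᶜ (sndᶜ idᶜ))) (pathStepᶜ (outerᶜ (outerᶜ zᶜ)) prevᶜ) (sndᶜ (sndᶜ idᶜ))))
    (outerᶜ vᶜ))
  (λ w q h → subst₂ (R (z w)) (fst-pair (x w) (fst q)) (neq≡0⇒≡ _ _ h) (follow-R (z w) (pair (x w) (fst q)) (snd q)))
  λ w r → let (l , n , eq) = Star→follow (R→Star r) in
    pair l n , ≡⇒neq≡0 (trans (cong₂ (λ a b → fst (follow (z w) (pair (x w) a) b)) (fst-pair l n) (snd-pair l n)) eq)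

-- Membership in Π⁰₃

-- Σ⁰₂ predicates, in the normal form ∃ b ∀ c.
record Lim (P : ℕ → Set) : Set where
  constructor lim
  field
    rel  : ℕ → ℕ → ℕ → ℕ
    relᶜ : Comp (λ p → rel (fst p) (fst (snd p)) (snd (snd p)))
    iff  : ∀ x → P x ⇔ (∃ λ b → ∀ c → rel x b c ≡ 0)
open Lim

rel-at : (L : Lim P) → Comp f → Comp g → Comp h → Comp (λ x → rel L (f x) (g x) (h x))
rel-at {f = f} {g} {h} L fᶜ gᶜ hᶜ = Comp-≗ eq (relᶜ L ∘ᶜ pairᶜ fᶜ (pairᶜ gᶜ hᶜ))
  where
  eq : ∀ x → let p = pair (f x) (pair (g x) (h x)) in
    rel L (fst p) (fst (snd p)) (snd (snd p)) ≡ rel L (f x) (g x) (h x)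
  eq x rewrite fst-pair (f x) (pair (g x) (h x)) | snd-pair (f x) (pair (g x) (h x))
             | fst-pair (g x) (h x) | snd-pair (g x) (h x) = refl

bᶜ : Comp (λ p → fst (snd p))
bᶜ = fstᶜ (sndᶜ idᶜ)

cᶜ : Comp (λ p → snd (snd p))
cᶜ = sndᶜ (sndᶜ idᶜ)

ifz≡0 : ∀ k → ifz k 1 0 ≡ 0 → k ≢ 0
ifz≡0 (suc k) _ ()

≢0⇒ifz≡0 : ∀ k → k ≢ 0 → ifz k 1 0 ≡ 0
≢0⇒ifz≡0 zero h = contradiction refl h
≢0⇒ifz≡0 (suc k) _ = refl

-- A difference of Σ⁰₁ predicates is Σ⁰₂: `b` witnesses the first, and no `c` witnesses the second.
_∖ˡ_ : Semi P → Semi Q → Lim (λ x → P x × ¬ Q x)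
S ∖ˡ T = lim (λ x b c → test S x b + ifz (test T x c) 1 0)
  (test-at S (fstᶜ idᶜ) bᶜ +ᶜ ifzᶜ (test-at T (fstᶜ idᶜ) cᶜ) (constᶜ 1) (constᶜ 0))
  λ x → mk⇔
    (λ (p , ¬q) → let (b , h) = complete S x p in
      b , λ c → cong₂ _+_ h (≢0⇒ifz≡0 (test T x c) (¬q ∘ sound T x c)))
    (λ (b , h) → sound S x b (m+n≡0⇒m≡0 _ (h 0)) ,
      λ q → let (c , hc) = complete T x q in
        ifz≡0 (test T x c) (m+n≡0⇒n≡0 (test S x b) (h c)) hc)

-- The first component of `b` selects the disjunct, so the two existential quantifiers merge into
-- one.
_⊎ˡ_ : Lim P → Lim Q → Lim (λ x → P x ⊎ Q x)
_⊎ˡ_ {P} {Q} L M = lim r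
  (ifzᶜ (fstᶜ bᶜ) (rel-at L (fstᶜ idᶜ) (sndᶜ bᶜ) cᶜ) (rel-at M (fstᶜ idᶜ) (sndᶜ bᶜ) cᶜ))
  λ x → mk⇔ (to x) λ (b , h) → from x (fst b) (snd b) h
  where
  r : ℕ → ℕ → ℕ → ℕ
  r x b c = ifz (fst b) (rel L x (snd b) c) (rel M x (snd b) c)
  r-pair : ∀ x i b c → r x (pair i b) c ≡ ifz i (rel L x b c) (rel M x b c)
  r-pair x i b c = cong₂ (λ i b → ifz i (rel L x b c) (rel M x b c)) (fst-pair i b) (snd-pair i b)
  to : ∀ x → P x ⊎ Q x → ∃ λ b → ∀ c → r x b c ≡ 0
  to x (inj₁ p) = let (b , h) = Equivalence.to (iff L x) p in
    pair 0 b , λ c → trans (r-pair x 0 b c) (h c)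
  to x (inj₂ q) = let (b , h) = Equivalence.to (iff M x) q in
    pair 1 b , λ c → trans (r-pair x 1 b c) (h c)
  from : ∀ x i b → (∀ c → ifz i (rel L x b c) (rel M x b c) ≡ 0) → P x ⊎ Q x
  from x zero b h = inj₁ (Equivalence.from (iff L x) (b , h))
  from x (suc _) b h = inj₂ (Equivalence.from (iff M x) (b , h))

∃ˡ : (P : ℕ → ℕ → Set) → Lim (λ p → P (fst p) (snd p)) → Lim (λ x → ∃ (P x))
∃ˡ P L = lim (λ x b c → rel L (pair x (fst b)) (snd b) c)
  (rel-at L (pairᶜ (fstᶜ idᶜ) (fstᶜ bᶜ)) (sndᶜ bᶜ) cᶜ)
  λ x → mk⇔
    (λ (y , p) → let (b , h) = Equivalence.to (iff L (pair x y)) (subst₂ P (sym (fst-pair x y)) (sym (snd-pair x y)) p) in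
      pair y b , λ c → trans (cong₂ (λ u v → rel L (pair x u) v c) (fst-pair y b) (snd-pair y b)) (h c))
    (λ (b , h) → fst b , subst₂ P (fst-pair x (fst b)) (snd-pair x (fst b)) (Equivalence.from (iff L _) (snd b , h)))

∀-Π⁰₃ : {A : ℕ → Set} (P : ℕ → ℕ → Set) → Lim (λ p → P (fst p) (snd p)) →
  (∀ x → A x ⇔ (∀ a → P x a)) → Π⁰₃ A
∀-Π⁰₃ {A} P L A⇔ = r , Comp→Computable rᶜ , λ x → mk⇔ (to x) (from x)
  where
  r : ℕ → ℕ
  r q = rel L (pair (fst q) (fst (snd q))) (fst (snd (snd q))) (snd (snd (snd q)))
  rᶜ : Comp r
  rᶜ = rel-at L (pairᶜ (fstᶜ idᶜ) bᶜ) (fstᶜ cᶜ) (sndᶜ cᶜ)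
  r-pair : ∀ x a b c → r (pair x (pair a (pair b c))) ≡ rel L (pair x a) b c
  r-pair x a b c rewrite fst-pair x (pair a (pair b c)) | snd-pair x (pair a (pair b c))
    | fst-pair a (pair b c) | snd-pair a (pair b c) | fst-pair b c | snd-pair b c = refl
  to : ∀ x → A x → ∀ a → ∃ λ b → ∀ c → r (pair x (pair a (pair b c))) ≡ 0
  to x Ax a =
    let (b , h) = Equivalence.to (iff L (pair x a))
          (subst₂ P (sym (fst-pair x a)) (sym (snd-pair x a)) (Equivalence.to (A⇔ x) Ax a))
    in b , λ c → trans (r-pair x a b c) (h c)
  from : ∀ x → (∀ a → ∃ λ b → ∀ c → r (pair x (pair a (pair b c))) ≡ 0) → A x
  from x h = Equivalence.from (A⇔ x) λ a → let (b , hb) = h a in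
    subst₂ P (fst-pair x a) (snd-pair x a)
      (Equivalence.from (iff L (pair x a)) (b , λ c → trans (sym (r-pair x a b c)) (hb c)))

-- q codes a pair of arguments of φₑ.
RelatedImages : ℕ → ℕ → ℕ → Set
RelatedImages i e q = ∃ λ w → Φ e (fst q) (fst w) × Φ e (snd q) (snd w) × R i (fst w) (snd w)

RelatedImagesˢ : Comp f → Comp e → Comp g → Semi (λ w → RelatedImages (f w) (e w) (g w))
RelatedImagesˢ {f} {e} {g} iᶜ eᶜ qᶜ =
  ∃ˢ (λ x w → Φ (e x) (fst (g x)) (fst w) × Φ (e x) (snd (g x)) (snd w) × R (f x) (fst w) (snd w))
    (Φˢ (outerᶜ eᶜ) (fstᶜ (outerᶜ qᶜ)) (fstᶜ (sndᶜ idᶜ)) ×ˢ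
    (Φˢ (outerᶜ eᶜ) (sndᶜ (outerᶜ qᶜ)) (sndᶜ (sndᶜ idᶜ)) ×ˢ
     Rˢ (outerᶜ iᶜ) (fstᶜ (sndᶜ idᶜ)) (sndᶜ (sndᶜ idᶜ))))

Hits : ℕ → ℕ → ℕ → ℕ → Set
Hits i e j k = ∃ λ u → Φ e k u × R i u j

Hitsˢ : Comp f → Comp e → Comp g → Comp h → Semi (λ w → Hits (f w) (e w) (g w) (h w))
Hitsˢ {f} {e} {g} {h} iᶜ eᶜ jᶜ kᶜ =
  ∃ˢ (λ x u → Φ (e x) (h x) u × R (f x) u (g x))
    (Φˢ (outerᶜ eᶜ) (outerᶜ kᶜ) (sndᶜ idᶜ) ×ˢ Rˢ (outerᶜ iᶜ) (sndᶜ idᶜ) (outerᶜ jᶜ))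

-- Divergence of φₑ at x needs no clause of its own: it is a failure of the
-- first kind at the pair (x , x).
Witness : ℕ → ℕ → ℕ → ℕ → Set
Witness i e j q =
  (R i (fst q) (snd q) × ¬ RelatedImages i e q) ⊎
  (RelatedImages i e q × ¬ R i (fst q) (snd q)) ⊎
  (Hits i e j q × ¬ (0 ≡ 1))

Witnessˡ : Lim (λ p → ∃ λ q → Witness (fst p) (fst (snd p)) (snd (snd p)) q)
Witnessˡ = ∃ˡ (λ p q → Witness (fst p) (fst (snd p)) (snd (snd p)) q)
  ((Rˢ iᶜ (fstᶜ qᶜ) (sndᶜ qᶜ) ∖ˡ RelatedImagesˢ iᶜ eᶜ qᶜ) ⊎ˡ
  ((RelatedImagesˢ iᶜ eᶜ qᶜ ∖ˡ Rˢ iᶜ (fstᶜ qᶜ) (sndᶜ qᶜ)) ⊎ˡ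
   -- Subtracting the empty predicate `0 ≡ 1` brings the Σ⁰₁ clause into the form of the other two.
   (Hitsˢ iᶜ eᶜ jᶜ qᶜ ∖ˡ ≡ˢ (constᶜ 0) (constᶜ 1))))
  where
  iᶜ = fstᶜ (fstᶜ idᶜ)
  eᶜ = fstᶜ (sndᶜ (fstᶜ idᶜ))
  jᶜ = sndᶜ (sndᶜ (fstᶜ idᶜ))
  qᶜ = sndᶜ idᶜ

module _ (em : ExcludedMiddle 0ℓ) where

  ¬¬-elim : ∀ {A : Set} → ¬ ¬ A → A
  ¬¬-elim = decidable-stable em

  -- Without a witness of the first two kinds φₑ is total and a reduction; self-fullness then
  -- supplies one of the third kind.
  selfFull⇒witness : ∀ i → SelfFull (R i) → ∀ e j → ∃ (Witness i e j)
  selfFull⇒witness i full e j = ¬¬-elim λ none →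
    let
      images : ∀ x y → R i x y → RelatedImages i e (pair x y)
      images x y r = ¬¬-elim λ ¬im → none (pair x y ,
        inj₁ (subst₂ (R i) (sym (fst-pair x y)) (sym (snd-pair x y)) r , ¬im))
      g : ℕ → ℕ
      -- The images of the reflexive pair at `x` exist, so φₑ converges at `x`.
      g x = fst (proj₁ (images x x rrefl))
      Φg : ∀ x → Φ e x (g x)
      Φg x = subst (λ a → Φ e a (g x)) (fst-pair x x) (proj₁ (proj₂ (images x x rrefl)))
      reduction : IsReduction (R i) g
      reduction x y = mk⇔
        (λ r → let (w , d , d′ , r′) = images x y r in
          subst₂ (R i)
            (Eval-functional (subst (λ a → Φ e a (fst w)) (fst-pair x y) d) (Φg x))
            (Eval-functional (subst (λ a → Φ e a (snd w)) (snd-pair x y) d′) (Φg y)) r′)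
        (λ r → ¬¬-elim λ ¬r → none (pair x y , inj₂ (inj₁
          ( (pair (g x) (g y)
            , subst₂ (Φ e) (sym (fst-pair x y)) (sym (fst-pair (g x) (g y))) (Φg x)
            , subst₂ (Φ e) (sym (snd-pair x y)) (sym (snd-pair (g x) (g y))) (Φg y)
            , subst₂ (R i) (sym (fst-pair (g x) (g y))) (sym (snd-pair (g x) (g y))) r)
          , λ r′ → ¬r (subst₂ (R i) (fst-pair x y) (snd-pair x y) r′)))))
      (k , r) = full g (e , Φg) reduction j
    in none (k , inj₂ (inj₂ ((g k , Φg k , r) , λ ())))

  -- The first two kinds of witness contradict that φₑ is the reduction `g`, which leaves a hit of
  -- the class of `j`.
  witness⇒selfFull : ∀ i → (∀ e j → ∃ (Witness i e j)) → SelfFull (R i)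
  witness⇒selfFull i wit g (e , Φg) red j with wit e j
  ... | q , inj₁ (r , ¬im) = contradiction
    ( pair (g (fst q)) (g (snd q))
    , subst (Φ e (fst q)) (sym (fst-pair (g (fst q)) (g (snd q)))) (Φg (fst q))
    , subst (Φ e (snd q)) (sym (snd-pair (g (fst q)) (g (snd q)))) (Φg (snd q))
    , subst₂ (R i) (sym (fst-pair (g (fst q)) (g (snd q)))) (sym (snd-pair (g (fst q)) (g (snd q))))
        (Equivalence.to (red (fst q) (snd q)) r)) ¬im
  ... | q , inj₂ (inj₁ ((w , d , d′ , r) , ¬r)) = contradiction
    (Equivalence.from (red (fst q) (snd q))
      (subst₂ (R i) (Eval-functional d (Φg (fst q))) (Eval-functional d′ (Φg (snd q))) r)) ¬r
  ... | k , inj₂ (inj₂ ((u , d , r) , _)) = k , subst (λ a → R i a j) (Eval-functional d (Φg k)) r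

  selfFull-Π⁰₃ : Π⁰₃ SelfFullIndex
  selfFull-Π⁰₃ = ∀-Π⁰₃ (λ i a → ∃ (Witness i (fst a) (snd a))) Witnessˡ λ i → mk⇔
    (λ full a → selfFull⇒witness i full (fst a) (snd a))
    (λ wit → witness⇒selfFull i λ e j →
      subst₂ (λ e j → ∃ (Witness i e j)) (fst-pair e j) (snd-pair e j) (wit (pair e j)))

-- Minimization and indices

Least : (ℕ → ℕ) → ℕ → Set
Least f w = f w ≡ 0 × (∀ i → i < w → f i ≢ 0)

least-or-none : ∀ f n → ∃ (Least f) ⊎ (∀ i → i < n → f i ≢ 0)
least-or-none f zero = inj₂ λ _ ()
least-or-none f (suc n) with least-or-none f n
... | inj₁ l = inj₁ l
... | inj₂ none with f n ≟ 0
...   | yes fn≡0 = inj₁ (n , fn≡0 , none)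
...   | no fn≢0 = inj₂ λ i i<sn → [ none i , (λ { refl → fn≢0 }) ]′ (m<1+n⇒m<n∨m≡n i<sn)

least-zero : ∀ f {w} → f w ≡ 0 → ∃ (Least f)
least-zero f {w} h with least-or-none f (suc w)
... | inj₁ l = l
... | inj₂ none = contradiction h (none w ≤-refl)

Least-unique : ∀ {f v w} → Least f v → Least f w → v ≡ w
Least-unique {v = v} {w} (hv , bv) (hw , bw) with <-cmp v w
... | tri< v<w _ _ = contradiction hv (bw v v<w)
... | tri≈ _ v≡w _ = v≡w
... | tri> _ _ w<v = contradiction hw (bv w w<v)

-- Counting zeros makes the bounded quantifier in `Least` computable.
zerosBelow : (ℕ → ℕ) → ℕ → ℕ
zerosBelow f = natrec 0 (λ i k → k + ifz (f i) 1 0)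

zerosBelow≡0⇒ : ∀ f w → zerosBelow f w ≡ 0 → ∀ i → i < w → f i ≢ 0
zerosBelow≡0⇒ f (suc w) h i i<sw with m<1+n⇒m<n∨m≡n i<sw
... | inj₁ i<w = zerosBelow≡0⇒ f w (m+n≡0⇒m≡0 _ h) i i<w
... | inj₂ refl = ifz≡0 (f i) (m+n≡0⇒n≡0 (zerosBelow f w) h)

⇒zerosBelow≡0 : ∀ f w → (∀ i → i < w → f i ≢ 0) → zerosBelow f w ≡ 0
⇒zerosBelow≡0 f zero h = refl
⇒zerosBelow≡0 f (suc w) h =
  cong₂ _+_ (⇒zerosBelow≡0 f w λ i i<w → h i (m<n⇒m<1+n i<w)) (≢0⇒ifz≡0 (f w) (h w ≤-refl))

Leastˢ : ∀ (F : ℕ → ℕ → ℕ) → Comp (λ p → F (fst p) (snd p)) → Comp g → Semi (λ x → Least (F x) (g x))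
Leastˢ {g} F Fᶜ gᶜ = dec-semi
  (Comp-≗ (λ x → cong₂ F (fst-pair x (g x)) (snd-pair x (g x))) (Fᶜ ∘ᶜ pairᶜ idᶜ gᶜ) +ᶜ
    recᶜ (λ x i k → k + ifz (F x i) 1 0) (constᶜ 0) (prevᶜ +ᶜ ifzᶜ step (constᶜ 1) (constᶜ 0)) gᶜ)
  (λ x h → m+n≡0⇒m≡0 _ h , zerosBelow≡0⇒ (F x) (g x) (m+n≡0⇒n≡0 (F x (g x)) h))
  (λ x (h , b) → cong₂ _+_ h (⇒zerosBelow≡0 (F x) (g x) b))
  where
  step : Comp (λ p → F (fst p) (fst (snd p)))
  step = Comp-≗ (λ p → cong₂ F (fst-pair (fst p) (fst (snd p))) (snd-pair (fst p) (fst (snd p))))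
    (Fᶜ ∘ᶜ pairᶜ (fstᶜ idᶜ) indexᶜ)

eval-pair : ∀ (F : ℕ → ℕ → ℕ) (Fᶜ : Comp (λ p → F (fst p) (snd p))) x y → Eval (code Fᶜ) (pair x y) (F x y)
eval-pair F Fᶜ x y = subst (Eval _ _) (cong₂ F (fst-pair x y) (snd-pair x y)) (eval Fᶜ (pair x y))

eval-mu : ∀ (F : ℕ → ℕ → ℕ) (Fᶜ : Comp (λ p → F (fst p) (snd p))) {x w} →
  Least (F x) w → Eval (muC (code Fᶜ)) x w
eval-mu F Fᶜ {x} {w} (h , below) = emu (subst (Eval _ _) h (eval-pair F Fᶜ x w)) λ i i<w →
  pred (F x i) , subst (Eval _ _) (sym (suc-pred (F x i) {{≢-nonZero (below i i<w)}})) (eval-pair F Fᶜ x i)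

leastᶜ : ∀ (F : ℕ → ℕ → ℕ) → Comp (λ p → F (fst p) (snd p)) → (∀ x → Least (F x) (f x)) → Comp f
leastᶜ F Fᶜ l = comp (muC (code Fᶜ)) λ x → eval-mu F Fᶜ (l x)

-- The index of a constant function, computed from the constant: `x` compositions with `succC`,
-- whose index is 1, starting from `zeroC`, whose index is 0.
constIndex : ℕ → ℕ
constIndex = natrec 0 (λ _ c → godel 6 (pair 1 c))

eval-const : ∀ x {y} → Eval (decode (constIndex x)) y x
eval-const zero = ezero
eval-const (suc x) {y} =
  subst (λ c → Eval c y (suc x)) (sym (decode-compC 1 (constIndex x))) (ecomp (eval-const x) esucc)

constIndexᶜ : Comp constIndex
constIndexᶜ = recᶜ (λ _ _ c → godel 6 (pair 1 c)) (constᶜ 0) (godelᶜ 6 (pairᶜ (constᶜ 1) prevᶜ)) idᶜ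

opaque
  -- The s-m-n theorem for Σ⁰₁ predicates: on input `y` the code searches for a witness at ⟨x,y⟩
  -- with `x` hard-wired, so its domain is the section of `P` at `x`. Index 2 is that of `idC`.
  semiIndex : Semi P → ℕ → ℕ
  semiIndex S x = godel 6 (pair (encode (muC (code (testᶜ S)))) (godel 5 (pair (constIndex x) 2)))

  semiIndexᶜ : (S : Semi P) → Comp (semiIndex S)
  semiIndexᶜ S = godelᶜ 6 (pairᶜ (constᶜ (encode (muC (code (testᶜ S))))) argumentᶜ)
    where
    argumentᶜ : Comp (λ x → godel 5 (pair (constIndex x) 2))
    argumentᶜ = godelᶜ 5 (pairᶜ constIndexᶜ (constᶜ 2))

  decode-semiIndex : (S : Semi P) → ∀ x →
    decode (semiIndex S x) ≡ compC (muC (code (testᶜ S))) (pairC (decode (constIndex x)) idC)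
  decode-semiIndex S x = trans (decode-compC (encode (muC (code (testᶜ S)))) _)
    (cong₂ compC (decode-encode (muC (code (testᶜ S)))) (decode-pairC (constIndex x) 2))

  W-semiIndex : (S : Semi P) → ∀ x y → W (semiIndex S x) y ⇔ P (pair x y)
  W-semiIndex {P} S x y = mk⇔ (λ (v , d) → to (subst (λ c → Eval c y v) (decode-semiIndex S x) d)) from
    where
    to : ∀ {v} → Eval (compC (muC (code (testᶜ S))) (pairC (decode (constIndex x)) idC)) y v → P (pair x y)
    to {v} (ecomp (epair d eid) (emu h _)) rewrite Eval-functional d (eval-const x) =
      sound S (pair x y) v (Eval-functional (eval-pair (test S) (testᶜ S) (pair x y) v) h)
    from : P (pair x y) → W (semiIndex S x) y
    from p = let (w , h) = complete S (pair x y) p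
                 (v , l) = least-zero (test S (pair x y)) h in
      v , subst (λ c → Eval c y v) (sym (decode-semiIndex S x))
        (ecomp (epair (eval-const x) eid) (eval-mu (test S) (testᶜ S) l))

-- Bounded predicates

Bounded : (ℕ → Set) → Set
Bounded P = ∃ λ M → ∀ u → P u → u < M

bounded-union : (Q : ℕ → ℕ → Set) → (∀ a → Bounded (Q a)) → ∀ n → Bounded (λ u → ∃ λ a → a < n × Q a u)
bounded-union Q bd zero = 0 , λ { u (_ , () , _) }
bounded-union Q bd (suc n) = M ⊔ N , below
  where
  M = proj₁ (bounded-union Q bd n)
  N = proj₁ (bd n)
  below : ∀ u → (∃ λ a → a < suc n × Q a u) → u < M ⊔ N
  below u (a , a<sn , q) with m<1+n⇒m<n∨m≡n a<sn
  ... | inj₁ a<n = <-≤-trans (proj₂ (bounded-union Q bd n) u (a , a<n , q)) (m≤m⊔n M N)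
  ... | inj₂ refl = <-≤-trans (proj₂ (bd n) u q) (m≤n⊔m M N)

injective-unbounded : (s : ℕ → ℕ) → (∀ {m n} → m < n → s m ≢ s n) → ∀ M → ¬ (∀ n → s n < M)
injective-unbounded s inj M s<M =
  let (i , j , i<j , eq) = pigeonhole (n<1+n M) (λ i → fromℕ< (s<M (toℕ i))) in
  inj i<j (trans (sym (toℕ-fromℕ< (s<M (toℕ i)))) (trans (cong toℕ eq) (toℕ-fromℕ< (s<M (toℕ j)))))

-- A state is a pair ⟨b , c⟩: while ρ vanishes, c increases; at a nonzero value, which
-- marks the current time, b increases and c restarts. So infinitely many times are
-- marked iff every row of ρ has a nonzero value.
walk : (ℕ → ℕ) → ℕ → ℕ
walk ρ = natrec (pair 0 0) (λ _ s → ifz (ρ s) (pair (fst s) (suc (snd s))) (pair (suc (fst s)) 0))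

module Walk (ρ : ℕ → ℕ) where

  row col : ℕ → ℕ
  row t = fst (walk ρ t)
  col t = snd (walk ρ t)

  Marked : ℕ → Set
  Marked t = ρ (walk ρ t) ≢ 0

  walk-unmarked : ∀ t → ρ (walk ρ t) ≡ 0 → walk ρ (suc t) ≡ pair (row t) (suc (col t))
  walk-unmarked t h = cong (λ k → ifz k (pair (row t) (suc (col t))) (pair (suc (row t)) 0)) h

  walk-marked : ∀ t → Marked t → walk ρ (suc t) ≡ pair (suc (row t)) 0
  walk-marked t m with ρ (walk ρ t)
  ... | zero = contradiction refl m
  ... | suc _ = refl

  row-unmarked : ∀ t → ρ (walk ρ t) ≡ 0 → row (suc t) ≡ row t
  row-unmarked t h = trans (cong fst (walk-unmarked t h)) (fst-pair (row t) _)

  row-marked : ∀ t → Marked t → row (suc t) ≡ suc (row t)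
  row-marked t m = trans (cong fst (walk-marked t m)) (fst-pair (suc (row t)) 0)

  col-unmarked : ∀ t → ρ (walk ρ t) ≡ 0 → col (suc t) ≡ suc (col t)
  col-unmarked t h = trans (cong snd (walk-unmarked t h)) (snd-pair (row t) _)

  col-marked : ∀ t → Marked t → col (suc t) ≡ 0
  col-marked t m = trans (cong snd (walk-marked t m)) (snd-pair (suc (row t)) 0)

  -- A new row starts at column 0, and columns advance only at zeros; all earlier columns of the
  -- current row were therefore seen to vanish.
  passed-zero : ∀ t c → c < col t → ρ (pair (row t) c) ≡ 0
  passed-zero zero c ()
  passed-zero (suc t) c c<col with ρ (walk ρ t) ≟ 0
  ... | no m = contradiction (subst (c <_) (col-marked t m) c<col) λ ()
  ... | yes h rewrite row-unmarked t h with m<1+n⇒m<n∨m≡n (subst (c <_) (col-unmarked t h) c<col)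
  ...   | inj₁ c<col′ = passed-zero t c c<col′
  ...   | inj₂ refl = trans (cong ρ (pair-unpair (walk ρ t))) h

  reach-column : ∀ k t → ρ (pair (row t) (col t + k)) ≢ 0 → ∃ λ t′ → t ≤ t′ × Marked t′
  reach-column zero t h = t , ≤-refl , λ z → h (trans (cong ρ (trans (cong (pair (row t)) (+-identityʳ (col t))) (pair-unpair (walk ρ t)))) z)
  reach-column (suc k) t h with ρ (walk ρ t) ≟ 0
  ... | no m = t , ≤-refl , m
  ... | yes z =
    let (t′ , st≤t′ , m) = reach-column k (suc t)
          (subst (λ s → ρ s ≢ 0) (sym (cong₂ pair (row-unmarked t z) (trans (cong (_+ k) (col-unmarked t z)) (sym (+-suc (col t) k))))) h)
    in t′ , <⇒≤ st≤t′ , m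

  -- A nonzero column of the current row cannot have been passed, so it lies ahead and is reached
  -- unless a mark comes first.
  marked-unbounded : (∀ b → ∃ λ c → ρ (pair b c) ≢ 0) → ∀ t → ∃ λ t′ → t ≤ t′ × Marked t′
  marked-unbounded rows t with rows (row t)
  ... | c , h with c <? col t
  ...   | yes c<col = contradiction (passed-zero t c c<col) h
  ...   | no c≮col = reach-column (c ∸ col t) t
    (subst (λ c → ρ (pair (row t) c) ≢ 0) (sym (m+[n∸m]≡n (≮⇒≥ c≮col))) h)

  -- Leaving row `b` would take a nonzero value in it.
  row≤ : ∀ {b} → (∀ c → ρ (pair b c) ≡ 0) → ∀ t → row t ≤ b
  row≤ zeros zero = z≤n
  row≤ zeros (suc t) with ρ (walk ρ t) ≟ 0
  ... | yes z = subst (_≤ _) (sym (row-unmarked t z)) (row≤ zeros t)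
  ... | no m with m≤n⇒m<n∨m≡n (row≤ zeros t)
  ...   | inj₁ lt = subst (_≤ _) (sym (row-marked t m)) lt
  ...   | inj₂ refl = contradiction (trans (cong ρ (sym (pair-unpair (walk ρ t)))) (zeros (col t))) m

  -- Every mark raises the row, which never exceeds `b`. The recursion in `go` is on the number `d`
  -- of marks still possible; excluded middle decides whether another one comes.
  marked-bounded : ExcludedMiddle 0ℓ → ∀ {b} → (∀ c → ρ (pair b c) ≡ 0) → Bounded Marked
  marked-bounded em {b} zeros = go (suc b) 0 (s≤s (m≤m+n b _))
    where
    go : ∀ d t → b < d + row t → Bounded Marked
    go zero t b<row = contradiction (row≤ zeros t) (<⇒≱ b<row)
    go (suc d) t lt with em {∃ λ t′ → t ≤ t′ × Marked t′}
    ... | no none = t , λ u m → ≰⇒> λ t≤u → none (u , t≤u , m)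
    ... | yes (t′ , t≤t′ , m) = go d (suc t′)
      (<-≤-trans lt (≤-trans (≤-reflexive (sym (+-suc d (row t))))
        (+-monoʳ-≤ d (subst (suc (row t) ≤_) (sym (row-marked t′ m)) (s≤s (row-mono t≤t′))))))
      where
      row-suc : ∀ t → row t ≤ row (suc t)
      row-suc t with ρ (walk ρ t) ≟ 0
      ... | yes z = ≤-reflexive (sym (row-unmarked t z))
      ... | no m = ≤-trans (n≤1+n (row t)) (≤-reflexive (sym (row-marked t m)))
      row-mono : ∀ {t u} → t ≤ u → row t ≤ row u
      row-mono t≤u with m≤n⇒m<n∨m≡n t≤u
      row-mono {u = suc u} _ | inj₁ (s≤s t≤u) = ≤-trans (row-mono t≤u) (row-suc u)
      row-mono _ | inj₂ refl = ≤-refl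

-- Hardness

-- The ceers in the image of the reduction: a single nontrivial class, the set A x.
-- The element ⟨a , t⟩ is protected against the requirements e ≥ a when time t is
-- marked for row a. Requirement e enumerates into A x the first value of φₑ that it
-- finds unprotected, hence at most one element.
module Hardness (em : ExcludedMiddle 0ℓ) (r : ℕ → ℕ) (rᶜ : Comp r) where

  -- With `s` read as ⟨b,c⟩, the Π⁰₃ condition says that for every `a` some row `b` vanishes.
  matrix : ℕ → ℕ → ℕ → ℕ
  matrix x a s = r (pair x (pair a s))

  opaque
    mark : ℕ → ℕ → ℕ → ℕ
    mark x a t = matrix x a (walk (matrix x a) t)

    markᶜ : Comp f → Comp g → Comp h → Comp (λ w → mark (f w) (g w) (h w))
    markᶜ {f} {g} {h} xᶜ aᶜ tᶜ = rᶜ ∘ᶜ pairᶜ xᶜ (pairᶜ aᶜ walkᶜ)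
      where
      walkᶜ : Comp (λ w → walk (matrix (f w) (g w)) (h w))
      walkᶜ = recᶜ
        (λ w _ s → ifz (matrix (f w) (g w) s) (pair (fst s) (suc (snd s))) (pair (suc (fst s)) 0))
        (constᶜ (pair 0 0))
        (ifzᶜ (rᶜ ∘ᶜ pairᶜ (outerᶜ xᶜ) (pairᶜ (outerᶜ aᶜ) prevᶜ))
          (pairᶜ (fstᶜ prevᶜ) (sucᶜ (sndᶜ prevᶜ))) (pairᶜ (sucᶜ (fstᶜ prevᶜ)) (constᶜ 0)))
        tᶜ

    mark-bounded : ∀ x a b → (∀ c → matrix x a (pair b c) ≡ 0) → Bounded (λ t → mark x a t ≢ 0)
    mark-bounded x a b = Walk.marked-bounded (matrix x a) em {b}

    mark-unbounded : ∀ x a → (∀ b → ∃ λ c → matrix x a (pair b c) ≢ 0) → ∀ t → ∃ λ t′ → t ≤ t′ × mark x a t′ ≢ 0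
    mark-unbounded x a = Walk.marked-unbounded (matrix x a)

  -- Zero iff requirement e may enumerate u.
  guard : ℕ → ℕ → ℕ → ℕ
  guard x e u = ifz (fst u ∸ e) (mark x (fst u) (snd u)) 0

  guardᶜ : Comp f → Comp g → Comp h → Comp (λ w → guard (f w) (g w) (h w))
  guardᶜ xᶜ eᶜ uᶜ = ifzᶜ (fstᶜ uᶜ ∸ᶜ eᶜ) (markᶜ xᶜ (fstᶜ uᶜ) (sndᶜ uᶜ)) (constᶜ 0)

  -- Here `w` codes an argument and a time bound; a computation that has not halted by then counts
  -- as failure, hence the value 1.
  found : ℕ → ℕ → ℕ → ℕ
  found x e w = ifz (run e (fst w) (snd w)) 1 (guard x e (pred (run e (fst w) (snd w))))

  foundᶜ : Comp f → Comp g → Comp h → Comp (λ w → found (f w) (g w) (h w))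
  foundᶜ xᶜ eᶜ wᶜ = ifzᶜ runsᶜ (constᶜ 1) (guardᶜ xᶜ eᶜ (predᶜ runsᶜ))
    where
    runsᶜ = runᶜ eᶜ (fstᶜ wᶜ) (sndᶜ wᶜ)

  opaque
    Chosen : ℕ → ℕ → ℕ → Set
    Chosen x e u = ∃ λ w → Least (found x e) w × run e (fst w) (snd w) ≡ suc u

    Chosenˢ : Comp f → Comp g → Comp h → Semi (λ q → Chosen (f q) (g q) (h q))
    Chosenˢ {f} {g} {h} xᶜ eᶜ uᶜ =
      ∃ˢ (λ q w → Least (found (f q) (g q)) w × run (g q) (fst w) (snd w) ≡ suc (h q))
        (Leastˢ (λ p → found (f (fst p)) (g (fst p)))
          (foundᶜ (outerᶜ (outerᶜ xᶜ)) (outerᶜ (outerᶜ eᶜ)) (sndᶜ idᶜ)) (sndᶜ idᶜ) ×ˢ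
         ≡ˢ (runᶜ (outerᶜ eᶜ) (fstᶜ (sndᶜ idᶜ)) (sndᶜ (sndᶜ idᶜ))) (sucᶜ (outerᶜ uᶜ)))

    chosen : ∀ {x e u} w → Least (found x e) w → run e (fst w) (snd w) ≡ suc u → Chosen x e u
    chosen w least runs = w , least , runs

    Chosen-unique : ∀ {x e u v} → Chosen x e u → Chosen x e v → u ≡ v
    Chosen-unique (w , least , hu) (w′ , least′ , hv) with Least-unique least least′
    ... | refl = suc-injective (trans (sym hu) hv)

    Chosen-guard : ∀ {x e u} → Chosen x e u → guard x e u ≡ 0
    Chosen-guard {x} {e} (w , (h , _) , hu) with run e (fst w) (snd w)
    Chosen-guard (w , (h , _) , refl) | suc _ = h

  A : ℕ → ℕ → Set
  A x u = ∃ λ e → Chosen x e u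

  Aˢ : Comp f → Comp g → Semi (λ q → A (f q) (g q))
  Aˢ {f} {g} xᶜ uᶜ = ∃ˢ (λ q e → Chosen (f q) e (g q)) (Chosenˢ (outerᶜ xᶜ) (sndᶜ idᶜ) (outerᶜ uᶜ))

  generatorsˢ : Semi (λ p → A (fst p) (fst (snd p)) × A (fst p) (snd (snd p)))
  generatorsˢ = Aˢ (fstᶜ idᶜ) bᶜ ×ˢ Aˢ (fstᶜ idᶜ) cᶜ

  opaque
    ceerIndex : ℕ → ℕ
    ceerIndex = semiIndex generatorsˢ

    ceerIndexᶜ : Comp ceerIndex
    ceerIndexᶜ = semiIndexᶜ generatorsˢ

    W-ceerIndex : ∀ x u v → W (ceerIndex x) (pair u v) ⇔ (A x u × A x v)
    W-ceerIndex x u v = subst (λ Q → W (ceerIndex x) (pair u v) ⇔ Q)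
      (cong₂ _×_
        (cong₂ A (fst-pair x (pair u v)) (trans (cong fst (snd-pair x (pair u v))) (fst-pair u v)))
        (cong₂ A (fst-pair x (pair u v)) (trans (cong snd (snd-pair x (pair u v))) (snd-pair u v))))
      (W-semiIndex generatorsˢ x (pair u v))

  E : ℕ → ℕ → ℕ → Set
  E x u v = u ≡ v ⊎ (A x u × A x v)

  R→E : ∀ {x u v} → R (ceerIndex x) u v → E x u v
  R→E {x} {u} {v} (gen w) = inj₂ (Equivalence.to (W-ceerIndex x u v) w)
  R→E rrefl = inj₁ refl
  R→E (rsym q) with R→E q
  ... | inj₁ eq = inj₁ (sym eq)
  ... | inj₂ (a , b) = inj₂ (b , a)
  R→E (rtrans q q′) with R→E q | R→E q′
  ... | inj₁ refl | e = e
  ... | inj₂ ab | inj₁ refl = inj₂ ab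
  ... | inj₂ (a , _) | inj₂ (_ , c) = inj₂ (a , c)

  E→R : ∀ {x u v} → E x u v → R (ceerIndex x) u v
  E→R (inj₁ refl) = rrefl
  E→R {x} {u} {v} (inj₂ ab) = gen (Equivalence.from (W-ceerIndex x u v) ab)

  -- Positive instances give self-full ceers

  module _ (x : ℕ) (rows-vanish : ∀ a → ∃ λ b → ∀ c → matrix x a (pair b c) ≡ 0) where

    -- Only the columns `a ≤ e` are closed to requirement `e`, and each has boundedly many marked
    -- times.
    guarded-bounded : ∀ e → Bounded (λ u → guard x e u ≢ 0)
    guarded-bounded e = M , below
      where
      column-bounded : ∀ a → Bounded (λ u → fst u ≡ a × mark x a (snd u) ≢ 0)
      column-bounded a =
        let (b , zeros) = rows-vanish a
            (T , t<T) = mark-bounded x a b zeros in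
        suc (pair a T) , λ { u (refl , m) →
          s≤s (subst (_≤ pair (fst u) T) (pair-unpair u) (pair-mono-≤ (≤-refl {fst u}) (<⇒≤ (t<T (snd u) m)))) }
      bound = bounded-union (λ a u → fst u ≡ a × mark x a (snd u) ≢ 0) column-bounded (suc e)
      M = proj₁ bound
      below : ∀ u → guard x e u ≢ 0 → u < M
      below u h with fst u ∸ e in eq
      ... | zero = proj₂ bound u (fst u , s≤s (m∸n≡0⇒m≤n eq) , refl , h)
      ... | suc _ = contradiction refl h

    -- An injective sequence leaves the bounded guarded set, so the search of the requirement for an
    -- index of `s` succeeds, though perhaps at another argument than the `n` that shows this.
    meets-A : {s : ℕ → ℕ} → Comp s → (∀ {m n} → m < n → s m ≢ s n) → ∃ λ n → A x (s n)
    meets-A {s} sᶜ inj = decidable-stable em λ avoids →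
      injective-unbounded s inj (proj₁ (guarded-bounded i)) λ n →
        proj₂ (guarded-bounded i) (s n) λ h → avoids (enumerated n h)
      where
      i : ℕ
      i = proj₁ (Comp→Computable sᶜ)
      Φs : ∀ n → Φ i n (s n)
      Φs = proj₂ (Comp→Computable sᶜ)
      enumerated : ∀ n → guard x i (s n) ≡ 0 → ∃ λ n → A x (s n)
      enumerated n h with run-complete i n (Φs n)
      ... | τ , halts = let (w , least) = least-zero (found x i) {pair n τ} found-n in
        fst w , i , chosen w least (value w (proj₁ least))
        where
        found-n : found x i (pair n τ) ≡ 0
        found-n rewrite fst-pair n τ | snd-pair n τ | halts = h
        value : ∀ w → found x i w ≡ 0 → run i (fst w) (snd w) ≡ suc (s (fst w))
        value w h with run i (fst w) (snd w) in eq
        ... | suc v = cong suc (Eval-functional (run-sound i (fst w) (snd w) eq) (Φs (fst w)))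

    selfFull : SelfFull (R (ceerIndex x))
    selfFull g gᶜ red j = decidable-stable em λ missed →
      let
        s : ℕ → ℕ
        s = natrec j (λ _ → g)
        sᶜ : Comp s
        sᶜ = recᶜ (λ _ _ → g) (constᶜ j) (Computable→Comp gᶜ ∘ᶜ prevᶜ) idᶜ
        inequivalent : ∀ {m n} → m < n → ¬ R (ceerIndex x) (s m) (s n)
        inequivalent = λ {m} {n} → orbit missed m n
        distinct : ∀ {m n} → m < n → s m ≢ s n
        distinct m<n eq = inequivalent m<n (subst (R (ceerIndex x) _) eq rrefl)
        (n , an) = meets-A sᶜ distinct
        -- The orbit beyond position `n` is again computable and injective, which yields a second,
        -- later element of `A x`.
        (m , am) = meets-A (sᶜ ∘ᶜ (constᶜ (suc n) +ᶜ idᶜ)) (λ i<k → distinct (+-monoʳ-< (suc n) i<k))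
      in inequivalent {n} {suc n + m} (s≤s (m≤m+n n m)) (E→R (inj₂ (an , am)))
      where
      -- The reduction lets `g` be cancelled on both sides until the left end is `j`; then `j` would
      -- be equivalent to a value of `g`.
      orbit : ¬ (Σ ℕ λ k → R (ceerIndex x) (g k) j) → ∀ m n → m < n →
        ¬ R (ceerIndex x) (natrec j (λ _ → g) m) (natrec j (λ _ → g) n)
      orbit missed zero (suc n) _ q = missed (natrec j (λ _ → g) n , rsym q)
      orbit missed (suc m) (suc n) (s≤s m<n) q = orbit missed m n m<n (Equivalence.from (red _ _) q)

  -- Negative instances give a reduction that misses a class

  module _ (x a : ℕ) (rows-hit : ∀ b → ∃ λ c → matrix x a (pair b c) ≢ 0) where

    chosen-bounded : ∀ e → Bounded (Chosen x e)
    chosen-bounded e with em {∃ (Chosen x e)}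
    ... | yes (u , ch) = suc u , λ v ch′ → s≤s (≤-reflexive (Chosen-unique ch′ ch))
    ... | no none = 0 , λ v ch → contradiction (v , ch) none

    -- Requirements `e < a` may enumerate protected elements of column `a`, but at most one each;
    -- all of these lie below this bound.
    N : ℕ
    N = proj₁ (bounded-union (Chosen x) chosen-bounded a)

    opaque
      -- Vanishes exactly on the protected elements of column a from N on.
      safe : ℕ → ℕ
      safe u = neq (fst u) a + ifz (mark x (fst u) (snd u)) 1 0 + (N ∸ u)

      safeᶜ : Comp f → Comp (λ w → safe (f w))
      safeᶜ uᶜ = neqᶜ (fstᶜ uᶜ) (constᶜ a) +ᶜ
        ifzᶜ (markᶜ (constᶜ x) (fstᶜ uᶜ) (sndᶜ uᶜ)) (constᶜ 1) (constᶜ 0) +ᶜ (constᶜ N ∸ᶜ uᶜ)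

      -- Requirements `e < a` enumerate only below `N`, and the others are stopped by the guard.
      safe∉A : ∀ u → safe u ≡ 0 → ¬ A x u
      safe∉A u h (e , ch) with e <? a
      ... | yes e<a = <⇒≱ (proj₂ (bounded-union (Chosen x) chosen-bounded a) u (e , e<a , ch)) (m∸n≡0⇒m≤n (m+n≡0⇒n≡0 _ h))
      ... | no e≮a = ifz≡0 _ (m+n≡0⇒n≡0 (neq (fst u) a) (m+n≡0⇒m≡0 _ h))
        (trans (sym (cong (λ k → ifz k (mark x (fst u) (snd u)) 0)
          (m≤n⇒m∸n≡0 (subst (_≤ e) (sym (neq≡0⇒≡ (fst u) a (m+n≡0⇒m≡0 _ (m+n≡0⇒m≡0 _ h)))) (≮⇒≥ e≮a)))))
          (Chosen-guard ch))

      safe-unbounded : ∀ M → ∃ λ u → M ≤ u × safe u ≡ 0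
      safe-unbounded M =
        let (t , M+N≤t , m) = mark-unbounded x a rows-hit (M + N)
            u≥M+N = ≤-trans M+N≤t (snd≤pair a t)
        in pair a t , ≤-trans (m≤m+n M N) u≥M+N ,
           cong₂ _+_
             (cong₂ _+_ (≡⇒neq≡0 (fst-pair a t))
               (≢0⇒ifz≡0 _ (subst₂ (λ b s → mark x b s ≢ 0) (sym (fst-pair a t)) (sym (snd-pair a t)) m)))
             (m≤n⇒m∸n≡0 (≤-trans (m≤n+m N M) u≥M+N))

    later : ℕ → ℕ → ℕ
    later y z = safe z + (suc y ∸ z)

    later-least : ∀ y → ∃ (Least (later y))
    later-least y = let (u , y<u , h) = safe-unbounded (suc y) in
      least-zero (later y) {u} (cong₂ _+_ h (m≤n⇒m∸n≡0 y<u))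

    opaque
      nextSafe : ℕ → ℕ
      nextSafe y = proj₁ (later-least y)

      nextSafe-safe : ∀ y → safe (nextSafe y) ≡ 0
      nextSafe-safe y = m+n≡0⇒m≡0 (safe (nextSafe y)) (proj₁ (proj₂ (later-least y)))

      nextSafe-> : ∀ y → y < nextSafe y
      nextSafe-> y = m∸n≡0⇒m≤n (m+n≡0⇒n≡0 (safe (nextSafe y)) (proj₁ (proj₂ (later-least y))))

      nextSafe-minimal : ∀ {y z} → y < z → safe z ≡ 0 → nextSafe y ≤ z
      nextSafe-minimal {y} {z} y<z h = ≮⇒≥ λ z<next →
        proj₂ (proj₂ (later-least y)) z z<next (cong₂ _+_ h (m≤n⇒m∸n≡0 y<z))

      nextSafeᶜ : Comp nextSafe
      nextSafeᶜ = leastᶜ later (safeᶜ (sndᶜ idᶜ) +ᶜ (sucᶜ (fstᶜ idᶜ) ∸ᶜ sndᶜ idᶜ)) (λ y → proj₂ (later-least y))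

    -- On safe elements `u < v` gives `nextSafe u ≤ v < nextSafe v`.
    nextSafe-injective : ∀ {u v} → safe u ≡ 0 → safe v ≡ 0 → nextSafe u ≡ nextSafe v → u ≡ v
    nextSafe-injective {u} {v} hu hv eq with <-cmp u v
    ... | tri< u<v _ _ = contradiction eq (<⇒≢ (≤-<-trans (nextSafe-minimal u<v hv) (nextSafe-> v)))
    ... | tri≈ _ u≡v _ = u≡v
    ... | tri> _ _ v<u = contradiction (sym eq) (<⇒≢ (≤-<-trans (nextSafe-minimal v<u hu) (nextSafe-> u)))

    shift : ℕ → ℕ
    shift y = ifz (safe y) (nextSafe y) y

    shiftᶜ : Comp shift
    shiftᶜ = ifzᶜ (safeᶜ idᶜ) nextSafeᶜ idᶜ

    data Shift (y : ℕ) : ℕ → Set where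
      moved : safe y ≡ 0 → Shift y (nextSafe y)
      fixed : safe y ≢ 0 → Shift y y

    shift-view : ∀ y → Shift y (shift y)
    shift-view y with safe y in eq
    ... | zero = moved eq
    ... | suc _ = fixed λ h → 1+n≢0 (trans (sym eq) h)

    -- A moved and a fixed element cannot share a value: the value of the former is safe, that of
    -- the latter is not.
    Shift-injective : ∀ {u v w} → Shift u w → Shift v w → u ≡ v
    Shift-injective {u} {v} {w} su sv = cases su sv refl
      where
      cases : ∀ {w w′} → Shift u w → Shift v w′ → w ≡ w′ → u ≡ v
      cases (moved hu) (moved hv) eq = nextSafe-injective hu hv eq
      cases (moved hu) (fixed nv) eq = contradiction (trans (cong safe (sym eq)) (nextSafe-safe u)) nv
      cases (fixed nu) (moved hv) eq = contradiction (trans (cong safe eq) (nextSafe-safe v)) nu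
      cases (fixed _) (fixed _) eq = eq

    Shift-A : ∀ {y z} → Shift y z → A x y ⇔ A x z
    Shift-A {y} (moved h) = mk⇔ (λ ay → contradiction ay (safe∉A y h))
      (λ az → contradiction az (safe∉A (nextSafe y) (nextSafe-safe y)))
    Shift-A (fixed _) = mk⇔ (λ ay → ay) (λ ay → ay)

    shift-A : ∀ y → A x y ⇔ A x (shift y)
    shift-A y = Shift-A (shift-view y)

    -- The classes are `A x` and singletons, so it suffices that `shift` is injective and respects
    -- membership in `A x` both ways.
    shift-reduction : IsReduction (R (ceerIndex x)) shift
    shift-reduction u v = mk⇔ (λ q → E→R (to (R→E q))) (λ q → E→R (from (R→E q)))
      where
      to : E x u v → E x (shift u) (shift v)
      to (inj₁ refl) = inj₁ refl
      to (inj₂ (au , av)) = inj₂ (Equivalence.to (shift-A u) au , Equivalence.to (shift-A v) av)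
      from : E x (shift u) (shift v) → E x u v
      from (inj₁ eq) = inj₁ (Shift-injective (shift-view u) (subst (Shift v) (sym eq) (shift-view v)))
      from (inj₂ (au , av)) = inj₂ (Equivalence.from (shift-A u) au , Equivalence.from (shift-A v) av)

    -- The least safe `j` is alone in its class and is not a value of `shift`: moved elements are
    -- safe and go to something larger than themselves, and fixed elements are not safe.
    not-selfFull : ¬ SelfFull (R (ceerIndex x))
    not-selfFull full =
      let (u , _ , safe-u) = safe-unbounded 0
          (j , safe-j , below) = least-zero safe {u} safe-u
          (k , q) = full shift (Comp→Computable shiftᶜ) shift-reduction j
      in missed j safe-j below k (R→E q)
      where
      missed : ∀ j → safe j ≡ 0 → (∀ i → i < j → safe i ≢ 0) → ∀ k → ¬ E x (shift k) j
      missed j safe-j below k (inj₂ (_ , aj)) = safe∉A j safe-j aj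
      missed j safe-j below k (inj₁ eq) = cases (shift-view k) eq
        where
        cases : ∀ {w} → Shift k w → w ≢ j
        cases (moved h) refl = below k (nextSafe-> k) h
        cases (fixed n) refl = n safe-j

selfFull-hard : ExcludedMiddle 0ℓ → ∀ (B : ℕ → Set) → Π⁰₃ B → B ≤ₘ SelfFullIndex
selfFull-hard em B (r , r-computable , B⇔) =
  ceerIndex , Comp→Computable ceerIndexᶜ , λ x → mk⇔
    (λ Bx → selfFull x (Equivalence.to (B⇔ x) Bx))
    (λ full → Equivalence.from (B⇔ x) λ a → decidable-stable em λ none →
      not-selfFull x a (λ b → decidable-stable em λ zeros →
        none (b , λ c → decidable-stable em λ h → zeros (c , h))) full)
  where
  open Hardness em r (Computable→Comp r-computable)

theorem12p2 : ExcludedMiddle 0ℓ → Π⁰₃-complete SelfFullIndex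
theorem12p2 em = selfFull-Π⁰₃ em , selfFull-hard em
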